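{- Let $k\ge0$, let $T$ be a semi-classical arithmetic, and let $X$ be a set of sentences of the language of $\mathsf{HA}$ all belonging to $\mathcal{Q}_{k+1}$. The following are pairwise equivalent: (1) $\mathsf{PA}+X$ is $\mathcal{V}_{k+1}$-conservative over $T+X$; (2) $\mathsf{PA}+X$ is $\Pi_{k+2}$-conservative over $T+X$; (3) $\mathsf{PA}+X$ is $\Sigma_{k+1}$-conservative over $T+X$; (4) $T+X$ is closed under $\mathrm{DNE\text{ - }R}(\Sigma_{k+1})$; (5) $T+X$ is closed under $\mathrm{DMLD\text{ - }R}(\Pi_{k+1})$; (6) $\mathsf{PA}+X$ is $\mathrm{E}_{k+1}$-conservative over $T+X$; (7) $\mathsf{PA}+X$ is $\mathrm{F}_k$-conservative over $T+X$; (8) $\mathsf{PA}+X$ is $(\Sigma_k\lor\Pi_k)$-conservative over $T+X$; (9) $T+X\vdash\mathrm{LEM}(\Sigma_k)$; (10) $T+X\vdash\mathrm{CD}(\Sigma_k)$; (11) $T+X$ is closed under $\mathrm{CD\text{ - }R}(\Sigma_k)$.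
   Context: $\mathsf{HA}$ is intuitionistic first-order arithmetic with function symbols for all primitive recursive functions and logical constants $\forall,\exists,\to,\land,\lor,\perp$ ($\neg\varphi:\equiv\varphi\to\perp$); $\mathsf{PA}$ is $\mathsf{HA}$ plus excluded middle for all formulas. A semi-classical arithmetic is a theory $T$ in the language of $\mathsf{HA}$ with $\mathsf{HA}\subseteq T\subseteq\mathsf{PA}$. $T+X$ adds the sentences of $X$ as axioms. $T'$ is $\Gamma$-conservative over $T$ if every formula of $\Gamma$ provable in $T'$ is provable in $T$. $\Sigma_0=\Pi_0$ = quantifier-free formulas; $\Sigma_{k+1}$ = formulas $\exists x_1\cdots\exists x_n\varphi$, $\varphi\in\Pi_k$; $\Pi_{k+1}$ = formulas $\forall x_1\cdots\forall x_n\varphi$, $\varphi\in\Sigma_k$. $\Sigma_k\lor\Pi_k$ = formulas $\varphi\lor\psi$ with $\varphi\in\Sigma_k$, $\psi\in\Pi_k$. $\mathrm{LEM}(\Sigma_k)$: $\varphi\lor\neg\varphi$ for $\varphi\in\Sigma_k$. $\mathrm{CD}(\Sigma_k)$: the scheme $\forall x(\varphi\lor\psi)\to\varphi\lor\forall x\psi$ for $\varphi,\psi\in\Sigma_k$ with $x$ not free in $\varphi$. Dual of a prenex formula: $\varphi^\perp:\equiv\neg\varphi$ if $\varphi$ is quantifier-free; $(\forall x\varphi)^\perp:\equiv\exists x\varphi^\perp$; $(\exists x\varphi)^\perp:\equiv\forall x\varphi^\perp$. Rules (formulas may contain free variables): $T$ is closed under $\mathrm{DNE\text{ - }R}(\Gamma)$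 if $T\vdash\neg\neg\varphi$ implies $T\vdash\varphi$ for all $\varphi\in\Gamma$; under $\mathrm{CD\text{ - }R}(\Gamma)$ if $T\vdash\forall x(\varphi\lor\psi)$ implies $T\vdash\varphi\lor\forall x\psi$ for all $\varphi,\psi\in\Gamma$ with $x$ not free in $\varphi$; under $\mathrm{DMLD\text{ - }R}(\Gamma)$ if $T\vdash\neg(\varphi\land\psi)$ implies $T\vdash\varphi^\perp\lor\psi^\perp$ for all $\varphi,\psi\in\Gamma$. Degree: an alternation path is a finite sequence of symbols $+,-$ in which they alternate; $i(s)$ is the first symbol of $s$ if nonempty and $\times$ if empty, $s^\perp$ swaps $+$ and $-$, $l(s)$ is the length. $\mathrm{Alt}(\varphi)=\{\langle\rangle\}$ for quantifier-free $\varphi$; otherwise $\mathrm{Alt}(\varphi_1\land\varphi_2)=\mathrm{Alt}(\varphi_1\lor\varphi_2)=\mathrm{Alt}(\varphi_1)\cup\mathrm{Alt}(\varphi_2)$, $\mathrm{Alt}(\varphi_1\to\varphi_2)=\{s^\perp:s\in\mathrm{Alt}(\varphi_1)\}\cup\mathrm{Alt}(\varphi_2)$, $\mathrm{Alt}(\forall x\varphi_1)=\{s\in\mathrm{Alt}(\varphi_1):i(s)=-\}\cup\{ -s:s\in\mathrm{Alt}(\varphi_1),i(s)\ne-\}$, $\mathrm{Alt}(\exists x\varphi_1)=\{s\in\mathrm{Alt}(\varphi_1):i(s)=+\}\cup\{+s:s\in\mathrm{Alt}(\varphi_1),i(s)\ne+\}$. $\deg(\varphi)=\max\{l(s):s\in\mathrm{Alt}(\varphi)\}$.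 $\mathrm{F}_k$ = formulas of degree exactly $k$; $\mathrm{F}_k^+$ = degree $\le k$; $\mathrm{E}_{k+1}$ = formulas $\varphi\in\mathrm{F}_{k+1}$ with $i(s)=+$ for all $s\in\mathrm{Alt}(\varphi)$ with $l(s)=k+1$. $\mathcal{R}_0=\mathcal{J}_0=\Sigma_0$; $\mathcal{R}_{k+1},\mathcal{J}_{k+1}$ are simultaneously generated by: every formula of $\mathrm{F}_k^+$ is in both; for $R,R'\in\mathcal{R}_{k+1}$, $J,J'\in\mathcal{J}_{k+1}$: $R\land R',R\lor R',\forall xR,J\to R\in\mathcal{R}_{k+1}$ and $J\land J',J\lor J',\exists xJ,R\to J\in\mathcal{J}_{k+1}$. $\mathcal{Q}_0=\Sigma_0$; $\mathcal{Q}_{k+1}$ is generated by prime formulas and closure under $\land,\lor,\forall x,\exists x$, and $J\to Q$ for $J\in\mathcal{J}_{k+1}$, $Q\in\mathcal{Q}_{k+1}$. $\mathcal{V}_{k+1}$ is generated by $\mathcal{J}_{k+1}$ and closure under $\land$ and $\forall x$. -}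

module Defs where

open import Data.Nat using (ℕ; zero; suc; _≤_; _⊔_)
open import Data.Fin using (Fin; zero; suc)
open import Data.Vec using (Vec; []; _∷_; lookup)
import Data.Vec as Vec
open import Data.List using (List; []; _∷_; _++_; map; length; foldr; head)
open import Data.List.Membership.Propositional using (_∈_)
open import Data.List.Relation.Unary.All using (All)
open import Data.Maybe using (Maybe; just; nothing)
open import Data.Product using (Σ; _×_; _,_)
open import Data.Sum using (_⊎_)
open import Relation.Binary.PropositionalEquality using (_≡_)

data PR : ℕ → Set where
  Zf : PR 0
  Sf : PR 1
  Pf : {n : ℕ} → Fin n → PR n
  Cf : {m n : ℕ} → PR m → Vec (PR n) m → PR n
  Rf : {n : ℕ} → PR n → PR (suc (suc n)) → PR (suc n)  -- primitive recursion (on 1st arg)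

data Term (n : ℕ) : Set where
  var : Fin n → Term n
  app : {k : ℕ} → PR k → Vec (Term n) k → Term n

𝟎 : {n : ℕ} → Term n
𝟎 = app Zf []

𝐒 : {n : ℕ} → Term n → Term n
𝐒 t = app Sf (t ∷ [])

infixr 6 _∧'_
infixr 5 _∨'_
infixr 4 _⇒_
infix 7 _≐_
data Formula (n : ℕ) : Set where
  _≐_  : Term n → Term n → Formula n
  ⊥'   : Formula n
  _∧'_ : Formula n → Formula n → Formula n
  _∨'_ : Formula n → Formula n → Formula n
  _⇒_  : Formula n → Formula n → Formula n
  ∀'   : Formula (suc n) → Formula n
  ∃'   : Formula (suc n) → Formula n

~_ : {n : ℕ} → Formula n → Formula n
~ φ = φ ⇒ ⊥'

mutual
  renT : {n m : ℕ} → (Fin n → Fin m) → Term n → Term m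
  renT ρ (var i) = var (ρ i)
  renT ρ (app f ts) = app f (renTs ρ ts)

  renTs : {n m k : ℕ} → (Fin n → Fin m) → Vec (Term n) k → Vec (Term m) k
  renTs ρ [] = []
  renTs ρ (t ∷ ts) = renT ρ t ∷ renTs ρ ts

mutual
  subT : {n m : ℕ} → (Fin n → Term m) → Term n → Term m
  subT σ (var i) = σ i
  subT σ (app f ts) = app f (subTs σ ts)

  subTs : {n m k : ℕ} → (Fin n → Term m) → Vec (Term n) k → Vec (Term m) k
  subTs σ [] = []
  subTs σ (t ∷ ts) = subT σ t ∷ subTs σ ts

lift : {n m : ℕ} → (Fin n → Term m) → Fin (suc n) → Term (suc m)
lift σ zero = var zero
lift σ (suc i) = renT suc (σ i)

sub : {n m : ℕ} → (Fin n → Term m) → Formula n → Formula m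
sub σ (t ≐ u) = subT σ t ≐ subT σ u
sub σ ⊥' = ⊥'
sub σ (a ∧' b) = sub σ a ∧' sub σ b
sub σ (a ∨' b) = sub σ a ∨' sub σ b
sub σ (a ⇒ b) = sub σ a ⇒ sub σ b
sub σ (∀' a) = ∀' (sub (lift σ) a)
sub σ (∃' a) = ∃' (sub (lift σ) a)

wk : {n : ℕ} → Formula n → Formula (suc n)
wk = sub (λ i → var (suc i))

_[_] : {n : ℕ} → Formula (suc n) → Term n → Formula n
φ [ t ] = sub σ φ
  where
  σ : _ → _
  σ zero = t
  σ (suc i) = var i

stepS : {n : ℕ} → Formula (suc n) → Formula (suc n)
stepS = sub σ
  where
  σ : _ → _
  σ zero = 𝐒 (var zero)
  σ (suc i) = var (suc i)

emb : {n : ℕ} → Formula 0 → Formula n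
emb = sub (λ ())

Theory : Set₁
Theory = {n : ℕ} → Formula n → Set

data Der (A : Theory) : {n : ℕ} → List (Formula n) → Formula n → Set where
  hyp  : {n : ℕ} {Γ : List (Formula n)} {φ : Formula n} → φ ∈ Γ → Der A Γ φ
  axm  : {n : ℕ} {Γ : List (Formula n)} {φ : Formula n} → A φ → Der A Γ φ
  ⊥E   : {n : ℕ} {Γ : List (Formula n)} {φ : Formula n} → Der A Γ ⊥' → Der A Γ φ
  ∧I   : {n : ℕ} {Γ : List (Formula n)} {a b : Formula n} → Der A Γ a → Der A Γ b → Der A Γ (a ∧' b)
  ∧E₁  : {n : ℕ} {Γ : List (Formula n)} {a b : Formula n} → Der A Γ (a ∧' b) → Der A Γ a
  ∧E₂  : {n : ℕ} {Γ : List (Formula n)} {a b : Formula n} → Der A Γ (a ∧' b) → Der A Γ b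
  ∨I₁  : {n : ℕ} {Γ : List (Formula n)} {a b : Formula n} → Der A Γ a → Der A Γ (a ∨' b)
  ∨I₂  : {n : ℕ} {Γ : List (Formula n)} {a b : Formula n} → Der A Γ b → Der A Γ (a ∨' b)
  ∨E   : {n : ℕ} {Γ : List (Formula n)} {a b c : Formula n} →
         Der A Γ (a ∨' b) → Der A (a ∷ Γ) c → Der A (b ∷ Γ) c → Der A Γ c
  ⇒I   : {n : ℕ} {Γ : List (Formula n)} {a b : Formula n} → Der A (a ∷ Γ) b → Der A Γ (a ⇒ b)
  ⇒E   : {n : ℕ} {Γ : List (Formula n)} {a b : Formula n} → Der A Γ (a ⇒ b) → Der A Γ a → Der A Γ b
  ∀I   : {n : ℕ} {Γ : List (Formula n)} {a : Formula (suc n)} → Der A (map wk Γ) a → Der A Γ (∀' a)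
  ∀E   : {n : ℕ} {Γ : List (Formula n)} {a : Formula (suc n)} → Der A Γ (∀' a) → (t : Term n) → Der A Γ (a [ t ])
  ∃I   : {n : ℕ} {Γ : List (Formula n)} {a : Formula (suc n)} → (t : Term n) → Der A Γ (a [ t ]) → Der A Γ (∃' a)
  ∃E   : {n : ℕ} {Γ : List (Formula n)} {a : Formula (suc n)} {c : Formula n} →
         Der A Γ (∃' a) → Der A (a ∷ map wk Γ) (wk c) → Der A Γ c
  eq-refl  : {n : ℕ} {Γ : List (Formula n)} (t : Term n) → Der A Γ (t ≐ t)
  eq-subst : {n : ℕ} {Γ : List (Formula n)} (a : Formula (suc n)) {t u : Term n} →
             Der A Γ (t ≐ u) → Der A Γ (a [ t ]) → Der A Γ (a [ u ])
  S≠0   : {n : ℕ} {Γ : List (Formula n)} (t : Term n) → Der A Γ (~ (𝐒 t ≐ 𝟎))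
  S-inj : {n : ℕ} {Γ : List (Formula n)} (t u : Term n) → Der A Γ (𝐒 t ≐ 𝐒 u ⇒ t ≐ u)
  ax-P  : {n k : ℕ} {Γ : List (Formula n)} (i : Fin k) (ts : Vec (Term n) k) →
          Der A Γ (app (Pf i) ts ≐ lookup ts i)
  ax-C  : {n k m : ℕ} {Γ : List (Formula n)} (f : PR m) (gs : Vec (PR k) m) (ts : Vec (Term n) k) →
          Der A Γ (app (Cf f gs) ts ≐ app f (Vec.map (λ g → app g ts) gs))
  ax-R0 : {n k : ℕ} {Γ : List (Formula n)} (f : PR k) (g : PR (suc (suc k))) (ts : Vec (Term n) k) →
          Der A Γ (app (Rf f g) (𝟎 ∷ ts) ≐ app f ts)
  ax-RS : {n k : ℕ} {Γ : List (Formula n)} (f : PR k) (g : PR (suc (suc k))) (t : Term n) (ts : Vec (Term n) k) →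
          Der A Γ (app (Rf f g) (𝐒 t ∷ ts) ≐ app g (app (Rf f g) (t ∷ ts) ∷ t ∷ ts))
  ind   : {n : ℕ} {Γ : List (Formula n)} (a : Formula (suc n)) →
          Der A Γ (a [ 𝟎 ]) → Der A Γ (∀' (a ⇒ stepS a)) → Der A Γ (∀' a)

_⊢_ : {n : ℕ} → Theory → Formula n → Set
A ⊢ φ = Der A [] φ

SentAx : (Formula 0 → Set) → Theory
SentAx S {n} φ = Σ (Formula 0) (λ ψ → S ψ × φ ≡ emb ψ)

_∪_ : (Formula 0 → Set) → (Formula 0 → Set) → (Formula 0 → Set)
(S ∪ S') ψ = S ψ ⊎ S' ψ

LEM-all : Theory
LEM-all {n} φ = Σ (Formula n) (λ ψ → φ ≡ (ψ ∨' ~ ψ))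

HA+ : (Formula 0 → Set) → Theory
HA+ S = SentAx S

PA+ : (Formula 0 → Set) → Theory
PA+ S {n} φ = LEM-all φ ⊎ SentAx S φ

∅ : Formula 0 → Set
∅ _ = Data.Empty.⊥
  where import Data.Empty

-- T (given by its set of sentences/axioms) is semi-classical: HA ⊆ T ⊆ PA.
-- (HA ⊆ HA + T holds by construction.)
SemiClassical : (Formula 0 → Set) → Set
SemiClassical T = (ψ : Formula 0) → T ψ → PA+ ∅ ⊢ ψ

FClass : Set₁
FClass = {n : ℕ} → Formula n → Set

data QF : FClass where
  qf-eq  : {n : ℕ} {t u : Term n} → QF (t ≐ u)
  qf-⊥   : {n : ℕ} → QF {n} ⊥'
  qf-∧   : {n : ℕ} {a b : Formula n} → QF a → QF b → QF (a ∧' b)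
  qf-∨   : {n : ℕ} {a b : Formula n} → QF a → QF b → QF (a ∨' b)
  qf-⇒   : {n : ℕ} {a b : Formula n} → QF a → QF b → QF (a ⇒ b)

data ExBlock (P : FClass) : FClass where
  ex-base : {n : ℕ} {φ : Formula n} → P φ → ExBlock P φ
  ex-step : {n : ℕ} {φ : Formula (suc n)} → ExBlock P φ → ExBlock P (∃' φ)

data AllBlock (P : FClass) : FClass where
  all-base : {n : ℕ} {φ : Formula n} → P φ → AllBlock P φ
  all-step : {n : ℕ} {φ : Formula (suc n)} → AllBlock P φ → AllBlock P (∀' φ)

mutual
  Sig : ℕ → FClass
  Sig zero = QF
  Sig (suc k) = ExBlock (Pi k)

  Pi : ℕ → FClass
  Pi zero = QF
  Pi (suc k) = AllBlock (Sig k)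

data SigOrPi (k : ℕ) : FClass where
  sop : {n : ℕ} {a b : Formula n} → Sig k a → Pi k b → SigOrPi k (a ∨' b)

-- dual of a prenex formula (the last clause covers the quantifier-free case;
-- it is only applied to prenex formulas)
dual : {n : ℕ} → Formula n → Formula n
dual (∀' a) = ∃' (dual a)
dual (∃' a) = ∀' (dual a)
dual φ = ~ φ

data Sign : Set where
  plus minus : Sign

Path : Set
Path = List Sign

flipS : Sign → Sign
flipS plus = minus
flipS minus = plus

flipP : Path → Path
flipP = map flipS

pre : Sign → Path → Path
pre plus (plus ∷ p) = plus ∷ p
pre minus (minus ∷ p) = minus ∷ p
pre s p = s ∷ p

-- Alt(φ) as a (finite, possibly repeating) list of alternation paths
Alt : {n : ℕ} → Formula n → List Path
Alt (t ≐ u) = [] ∷ []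
Alt ⊥' = [] ∷ []
Alt (a ∧' b) = Alt a ++ Alt b
Alt (a ∨' b) = Alt a ++ Alt b
Alt (a ⇒ b) = map flipP (Alt a) ++ Alt b
Alt (∀' a) = map (pre minus) (Alt a)
Alt (∃' a) = map (pre plus) (Alt a)

deg : {n : ℕ} → Formula n → ℕ
deg φ = foldr (λ p m → length p ⊔ m) 0 (Alt φ)

F : ℕ → FClass
F k φ = deg φ ≡ k

F⁺ : ℕ → FClass
F⁺ k φ = deg φ ≤ k

E-suc : ℕ → FClass
E-suc k φ = F (suc k) φ × All (λ s → length s ≡ suc k → head s ≡ just plus) (Alt φ)

mutual
  -- R⁺ k = R_{k+1}
  data R⁺ (k : ℕ) : FClass where
    R-base : {n : ℕ} {φ : Formula n} → F⁺ k φ → R⁺ k φ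
    R-∧    : {n : ℕ} {a b : Formula n} → R⁺ k a → R⁺ k b → R⁺ k (a ∧' b)
    R-∨    : {n : ℕ} {a b : Formula n} → R⁺ k a → R⁺ k b → R⁺ k (a ∨' b)
    R-∀    : {n : ℕ} {a : Formula (suc n)} → R⁺ k a → R⁺ k (∀' a)
    R-⇒    : {n : ℕ} {a b : Formula n} → J⁺ k a → R⁺ k b → R⁺ k (a ⇒ b)

  -- J⁺ k = J_{k+1}
  data J⁺ (k : ℕ) : FClass where
    J-base : {n : ℕ} {φ : Formula n} → F⁺ k φ → J⁺ k φ
    J-∧    : {n : ℕ} {a b : Formula n} → J⁺ k a → J⁺ k b → J⁺ k (a ∧' b)
    J-∨    : {n : ℕ} {a b : Formula n} → J⁺ k a → J⁺ k b → J⁺ k (a ∨' b)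
    J-∃    : {n : ℕ} {a : Formula (suc n)} → J⁺ k a → J⁺ k (∃' a)
    J-⇒    : {n : ℕ} {a b : Formula n} → R⁺ k a → J⁺ k b → J⁺ k (a ⇒ b)

-- Q⁺ k = Q_{k+1}   (prime formulas: equations and ⊥)
data Q⁺ (k : ℕ) : FClass where
  Q-eq : {n : ℕ} {t u : Term n} → Q⁺ k (t ≐ u)
  Q-⊥  : {n : ℕ} → Q⁺ k {n} ⊥'
  Q-∧  : {n : ℕ} {a b : Formula n} → Q⁺ k a → Q⁺ k b → Q⁺ k (a ∧' b)
  Q-∨  : {n : ℕ} {a b : Formula n} → Q⁺ k a → Q⁺ k b → Q⁺ k (a ∨' b)
  Q-∀  : {n : ℕ} {a : Formula (suc n)} → Q⁺ k a → Q⁺ k (∀' a)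
  Q-∃  : {n : ℕ} {a : Formula (suc n)} → Q⁺ k a → Q⁺ k (∃' a)
  Q-⇒  : {n : ℕ} {a b : Formula n} → J⁺ k a → Q⁺ k b → Q⁺ k (a ⇒ b)

-- V⁺ k = V_{k+1}
data V⁺ (k : ℕ) : FClass where
  V-base : {n : ℕ} {φ : Formula n} → J⁺ k φ → V⁺ k φ
  V-∧    : {n : ℕ} {a b : Formula n} → V⁺ k a → V⁺ k b → V⁺ k (a ∧' b)
  V-∀    : {n : ℕ} {a : Formula (suc n)} → V⁺ k a → V⁺ k (∀' a)

Conservative : FClass → Theory → Theory → Set
Conservative Γ A' A = {n : ℕ} (φ : Formula n) → Γ φ → A' ⊢ φ → A ⊢ φ

ClosedDNE-R : FClass → Theory → Set
ClosedDNE-R Γ A = {n : ℕ} (φ : Formula n) → Γ φ → A ⊢ (~ (~ φ)) → A ⊢ φ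

-- x (the bound variable) not free in φ is expressed by weakening φ
ClosedCD-R : FClass → Theory → Set
ClosedCD-R Γ A = {n : ℕ} (φ : Formula n) (ψ : Formula (suc n)) → Γ φ → Γ ψ →
                 A ⊢ ∀' (wk φ ∨' ψ) → A ⊢ (φ ∨' ∀' ψ)

ClosedDMLD-R : FClass → Theory → Set
ClosedDMLD-R Γ A = {n : ℕ} (φ ψ : Formula n) → Γ φ → Γ ψ →
                   A ⊢ (~ (φ ∧' ψ)) → A ⊢ (dual φ ∨' dual ψ)

ProvesLEM : FClass → Theory → Set
ProvesLEM Γ A = {n : ℕ} (φ : Formula n) → Γ φ → A ⊢ (φ ∨' ~ φ)

ProvesCD : FClass → Theory → Set
ProvesCD Γ A = {n : ℕ} (φ : Formula n) (ψ : Formula (suc n)) → Γ φ → Γ ψ →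
               A ⊢ (∀' (wk φ ∨' ψ) ⇒ (φ ∨' ∀' ψ))

Cond : ℕ → (Formula 0 → Set) → (Formula 0 → Set) → ℕ → Set
Cond k T X 1  = Conservative (V⁺ k) (PA+ X) (HA+ (T ∪ X))
Cond k T X 2  = Conservative (Pi (suc (suc k))) (PA+ X) (HA+ (T ∪ X))
Cond k T X 3  = Conservative (Sig (suc k)) (PA+ X) (HA+ (T ∪ X))
Cond k T X 4  = ClosedDNE-R (Sig (suc k)) (HA+ (T ∪ X))
Cond k T X 5  = ClosedDMLD-R (Pi (suc k)) (HA+ (T ∪ X))
Cond k T X 6  = Conservative (E-suc k) (PA+ X) (HA+ (T ∪ X))
Cond k T X 7  = Conservative (F k) (PA+ X) (HA+ (T ∪ X))
Cond k T X 8  = Conservative (SigOrPi k) (PA+ X) (HA+ (T ∪ X))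
Cond k T X 9  = ProvesLEM (Sig k) (HA+ (T ∪ X))
Cond k T X 10 = ProvesCD (Sig k) (HA+ (T ∪ X))
Cond k T X 11 = ClosedCD-R (Sig k) (HA+ (T ∪ X))
Cond k T X _  = Data.Unit.⊤
  where import Data.Unit

{-# OPTIONS --safe #-}

-- Everything reduces to LEM(Σ_k), condition (9). Prenexing shows that LEM(Σ_k) makes every formula of degree ≤ k
-- decidable. Conservation then follows from a call-by-value negative translation φ ↦ K C (⟦ φ ⟧ C),
-- K C a = (a → C) → C, with an arbitrary answer formula C. For φ of degree ≤ k decidability gives φ → ⟦ φ ⟧ C and
-- ⟦ φ ⟧ C → φ ∨ C; this extends to (¬R → C) → K C (⟦ R ⟧ C) for R ∈ 𝓡, to ⟦ J ⟧ C → K C J for J ∈ 𝓙 and to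
-- Q → K C (⟦ Q ⟧ C) for Q ∈ 𝓠. Hence the axioms X survive the translation, and taking C = J turns a classical
-- proof of J ∈ 𝓙 into a proof of J.
-- Conversely, the rules DNE and CD yield LEM(Σ_j) by induction on j ≤ k. For DNE, φ ∨ φ^⊥ with φ ∈ Σ_{j+1} is
-- Σ_{j+2} up to LEM(Σ_j). For CD, a block of quantifiers has to be merged into the single quantifier of the rule by
-- means of Cantor pairing.

module Submission where

open import Defs
open import Data.Empty using (⊥; ⊥-elim)
open import Data.Fin using (Fin; zero; suc)
open import Data.Fin.Patterns using (0F; 1F; 2F; 3F; 4F)
open import Data.List using (List; []; _∷_; _++_; map; length; foldr; head)
open import Data.List.Membership.Propositional.Properties using (∈-map⁺)
open import Data.List.Properties using (map-∘; map-cong)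
open import Data.List.Relation.Binary.Subset.Propositional using (_⊆_)
open import Data.List.Relation.Binary.Subset.Propositional.Properties using (map⁺; ∷⁺ʳ)
open import Data.List.Relation.Unary.All using (All; []; _∷_)
import Data.List.Relation.Unary.All as All
import Data.List.Relation.Unary.All.Properties as Allₚ
open import Data.List.Relation.Unary.Any using (here; there)
open import Data.Maybe using (just)
open import Data.Nat using (ℕ; zero; suc; _≤_; _<_; z≤n; s≤s; _⊔_)
open import Data.Nat.Properties using (≤-refl; ≤-trans; ≤-reflexive; ≤-antisym; <⇒≢; n≤1+n; n<1+n; m<n⇒m<1+n; m≤n⇒m<n∨m≡n; ⊔-lub; m⊔n≤o⇒m≤o; m⊔n≤o⇒n≤o)
open import Data.Product using (Σ; ∃; _×_; _,_; proj₁; proj₂)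
open import Data.Sum using (inj₁; inj₂)
open import Data.Vec using (Vec; []; _∷_; lookup)
import Data.Vec as Vec
open import Function using (_∘_)
open import Relation.Binary.PropositionalEquality using (_≡_; refl; sym; trans; cong; cong₂; subst)

-- Substitution

-- The answer formula plays the role of Friedman's parameter: with C = J the final continuation is
-- the identity on J. `⊥'` stays `⊥'`, so ex falso and the axioms on the successor keep their
-- proofs, while K C ⊥ amounts to C. Call-by-value matters because ∧, ∨ and ∃ then keep their shape
-- and K appears only in the conclusion of an implication and under ∀; the universal quantifier is
-- therefore the hard case of ⟦ φ ⟧ C → φ ∨ C. The hypothesis ¬R → C for R ∈ 𝓡 comes from
-- implications R → J: there R itself is not at hand, but a continuation (R → J) → C sends a
-- refutation of R to C. The rules used in the converse directions have tight shapes. DNE applies to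
-- one Σ-formula, so a disjunction has to be brought to that form. CD needs Σ-formulas on both sides
-- of the disjunction and has a single variable, whereas the dual of a Σ-formula is a Π-formula with
-- a block of quantifiers: φ must be complemented by a family of Σ-formulas ψ(z) such that φ ∨ ψ(z)
-- is already provable from lower levels.

Subst : ℕ → ℕ → Set
Subst n m = Fin n → Term m

mutual
  subT-ext : ∀ {n m} {σ τ : Subst n m} → (∀ i → σ i ≡ τ i) → ∀ t → subT σ t ≡ subT τ t
  subT-ext e (var i) = e i
  subT-ext e (app f ts) = cong (app f) (subTs-ext e ts)

  subTs-ext : ∀ {n m k} {σ τ : Subst n m} → (∀ i → σ i ≡ τ i) → (ts : Vec (Term n) k) → subTs σ ts ≡ subTs τ ts
  subTs-ext e [] = refl
  subTs-ext e (t ∷ ts) = cong₂ _∷_ (subT-ext e t) (subTs-ext e ts)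

mutual
  renT-subT : ∀ {n m} (ρ : Fin n → Fin m) t → renT ρ t ≡ subT (var ∘ ρ) t
  renT-subT ρ (var i) = refl
  renT-subT ρ (app f ts) = cong (app f) (renTs-subTs ρ ts)

  renTs-subTs : ∀ {n m k} (ρ : Fin n → Fin m) (ts : Vec (Term n) k) → renTs ρ ts ≡ subTs (var ∘ ρ) ts
  renTs-subTs ρ [] = refl
  renTs-subTs ρ (t ∷ ts) = cong₂ _∷_ (renT-subT ρ t) (renTs-subTs ρ ts)

mutual
  subT-subT : ∀ {n m l} (τ : Subst m l) (σ : Subst n m) t → subT τ (subT σ t) ≡ subT (subT τ ∘ σ) t
  subT-subT τ σ (var i) = refl
  subT-subT τ σ (app f ts) = cong (app f) (subTs-subTs τ σ ts)

  subTs-subTs : ∀ {n m l k} (τ : Subst m l) (σ : Subst n m) (ts : Vec (Term n) k) →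
                subTs τ (subTs σ ts) ≡ subTs (subT τ ∘ σ) ts
  subTs-subTs τ σ [] = refl
  subTs-subTs τ σ (t ∷ ts) = cong₂ _∷_ (subT-subT τ σ t) (subTs-subTs τ σ ts)

mutual
  subT-id : ∀ {n} (t : Term n) → subT var t ≡ t
  subT-id (var i) = refl
  subT-id (app f ts) = cong (app f) (subTs-id ts)

  subTs-id : ∀ {n k} (ts : Vec (Term n) k) → subTs var ts ≡ ts
  subTs-id [] = refl
  subTs-id (t ∷ ts) = cong₂ _∷_ (subT-id t) (subTs-id ts)

subT-renT : ∀ {n m l} (τ : Subst m l) (ρ : Fin n → Fin m) t → subT τ (renT ρ t) ≡ subT (τ ∘ ρ) t
subT-renT τ ρ t = trans (cong (subT τ) (renT-subT ρ t)) (subT-subT τ (var ∘ ρ) t)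

lift-ext : ∀ {n m} {σ τ : Subst n m} → (∀ i → σ i ≡ τ i) → ∀ i → lift σ i ≡ lift τ i
lift-ext e zero = refl
lift-ext e (suc i) = cong (renT suc) (e i)

lift-lift : ∀ {n m l} (τ : Subst m l) (σ : Subst n m) i → subT (lift τ) (lift σ i) ≡ lift (subT τ ∘ σ) i
lift-lift τ σ zero = refl
lift-lift τ σ (suc i) =
  trans (subT-renT (lift τ) suc (σ i))
  (trans (subT-ext (λ j → renT-subT suc (τ j)) (σ i))
  (trans (sym (subT-subT (var ∘ suc) τ (σ i))) (sym (renT-subT suc (subT τ (σ i))))))

sub-ext : ∀ {n m} {σ τ : Subst n m} → (∀ i → σ i ≡ τ i) → ∀ φ → sub σ φ ≡ sub τ φ
sub-ext e (t ≐ u) = cong₂ _≐_ (subT-ext e t) (subT-ext e u)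
sub-ext e ⊥' = refl
sub-ext e (a ∧' b) = cong₂ _∧'_ (sub-ext e a) (sub-ext e b)
sub-ext e (a ∨' b) = cong₂ _∨'_ (sub-ext e a) (sub-ext e b)
sub-ext e (a ⇒ b) = cong₂ _⇒_ (sub-ext e a) (sub-ext e b)
sub-ext e (∀' a) = cong ∀' (sub-ext (lift-ext e) a)
sub-ext e (∃' a) = cong ∃' (sub-ext (lift-ext e) a)

sub-sub : ∀ {n m l} (τ : Subst m l) (σ : Subst n m) φ → sub τ (sub σ φ) ≡ sub (subT τ ∘ σ) φ
sub-sub τ σ (t ≐ u) = cong₂ _≐_ (subT-subT τ σ t) (subT-subT τ σ u)
sub-sub τ σ ⊥' = refl
sub-sub τ σ (a ∧' b) = cong₂ _∧'_ (sub-sub τ σ a) (sub-sub τ σ b)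
sub-sub τ σ (a ∨' b) = cong₂ _∨'_ (sub-sub τ σ a) (sub-sub τ σ b)
sub-sub τ σ (a ⇒ b) = cong₂ _⇒_ (sub-sub τ σ a) (sub-sub τ σ b)
sub-sub τ σ (∀' a) = cong ∀' (trans (sub-sub (lift τ) (lift σ) a) (sub-ext (lift-lift τ σ) a))
sub-sub τ σ (∃' a) = cong ∃' (trans (sub-sub (lift τ) (lift σ) a) (sub-ext (lift-lift τ σ) a))

lift-var : ∀ {n} (i : Fin (suc n)) → lift var i ≡ var i
lift-var zero = refl
lift-var (suc i) = refl

sub-id : ∀ {n} (φ : Formula n) → sub var φ ≡ φ
sub-id (t ≐ u) = cong₂ _≐_ (subT-id t) (subT-id u)
sub-id ⊥' = refl
sub-id (a ∧' b) = cong₂ _∧'_ (sub-id a) (sub-id b)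
sub-id (a ∨' b) = cong₂ _∨'_ (sub-id a) (sub-id b)
sub-id (a ⇒ b) = cong₂ _⇒_ (sub-id a) (sub-id b)
sub-id (∀' a) = cong ∀' (trans (sub-ext lift-var a) (sub-id a))
sub-id (∃' a) = cong ∃' (trans (sub-ext lift-var a) (sub-id a))

sub-comm : ∀ {n m m' l} (τ : Subst m l) (σ : Subst n m) (τ' : Subst m' l) (σ' : Subst n m') →
           (∀ i → subT τ (σ i) ≡ subT τ' (σ' i)) → ∀ φ → sub τ (sub σ φ) ≡ sub τ' (sub σ' φ)
sub-comm τ σ τ' σ' e φ = trans (sub-sub τ σ φ) (trans (sub-ext e φ) (sym (sub-sub τ' σ' φ)))

inst : ∀ {n} → Term n → Subst (suc n) n
inst t zero = t
inst t (suc i) = var i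

-- The substitutions behind `_[_]` and `stepS` are local to their definitions; `inst` and `stepσ`
-- are copies that can be named and computed with.
[]-inst : ∀ {n} (a : Formula (suc n)) t → a [ t ] ≡ sub (inst t) a
[]-inst a t = sub-ext (λ { zero → refl ; (suc i) → refl }) a

stepσ : ∀ {n} → Subst (suc n) (suc n)
stepσ zero = 𝐒 (var zero)
stepσ (suc i) = var (suc i)

stepS-sub : ∀ {n} (a : Formula (suc n)) → stepS a ≡ sub stepσ a
stepS-sub = sub-ext (λ { zero → refl ; (suc i) → refl })

subT-inst-renT : ∀ {n} (t u : Term n) → subT (inst t) (renT suc u) ≡ u
subT-inst-renT t u = trans (subT-renT (inst t) suc u) (subT-id u)

wk-inst : ∀ {n} (a : Formula n) t → wk a [ t ] ≡ a
wk-inst a t = trans ([]-inst (wk a) t) (trans (sub-sub (inst t) (var ∘ suc) a) (sub-id a))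

lift-wk : ∀ {n m} (σ : Subst n m) a → sub (lift σ) (wk a) ≡ wk (sub σ a)
lift-wk σ = sub-comm (lift σ) (var ∘ suc) (var ∘ suc) σ (λ i → renT-subT suc (σ i))

sub-inst : ∀ {n m} (σ : Subst n m) a t → sub σ (a [ t ]) ≡ sub (lift σ) a [ subT σ t ]
sub-inst σ a t =
  trans (cong (sub σ) ([]-inst a t))
  (trans (sub-comm σ (inst t) (inst (subT σ t)) (lift σ)
           (λ { zero → refl ; (suc i) → sym (subT-inst-renT (subT σ t) (σ i)) }) a)
  (sym ([]-inst (sub (lift σ) a) (subT σ t))))

sub-stepS : ∀ {n m} (σ : Subst n m) a → sub (lift σ) (stepS a) ≡ stepS (sub (lift σ) a)
sub-stepS σ a =
  trans (cong (sub (lift σ)) (stepS-sub a))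
  (trans (sub-comm (lift σ) stepσ stepσ (lift σ)
           (λ { zero → refl
              ; (suc i) → trans (renT-subT suc (σ i)) (sym (subT-renT stepσ suc (σ i))) }) a)
  (sym (stepS-sub (sub (lift σ) a))))

-- Under a binder this lets a quantified hypothesis be opened at the fresh variable, giving back its
-- original body; see `∀E₀` and `∃I₀`.
wk-body : ∀ {n} (a : Formula (suc n)) → sub (lift (var ∘ suc)) a [ var zero ] ≡ a
wk-body a =
  trans ([]-inst (sub (lift (var ∘ suc)) a) (var zero))
  (trans (sub-sub (inst (var zero)) (lift (var ∘ suc)) a)
  (trans (sub-ext (λ { zero → refl ; (suc i) → refl }) a) (sub-id a)))

sub-emb : ∀ {n m} (σ : Subst n m) ψ → sub σ (emb ψ) ≡ emb ψ
sub-emb σ ψ = trans (sub-sub σ _ ψ) (sub-ext (λ ()) ψ)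

map-commute : ∀ {A B C D : Set} {f : A → B} {g : B → D} {h : A → C} {k : C → D} →
              (∀ x → g (f x) ≡ k (h x)) → ∀ xs → map g (map f xs) ≡ map k (map h xs)
map-commute e xs = trans (sym (map-∘ xs)) (trans (map-cong e xs) (map-∘ xs))

map-lift-wk : ∀ {n m} (σ : Subst n m) Γ → map (sub (lift σ)) (map wk Γ) ≡ map wk (map (sub σ) Γ)
map-lift-wk σ = map-commute (lift-wk σ)

-- Change of theory, weakening and substitution of derivations

Der-map : ∀ {A B : Theory} → (∀ {n} {Γ : List (Formula n)} {φ} → A φ → Der B Γ φ) →
          ∀ {n} {Γ Δ : List (Formula n)} {φ} → Γ ⊆ Δ → Der A Γ φ → Der B Δ φ
Der-map h s (hyp x) = hyp (s x)
Der-map h s (axm x) = h x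
Der-map h s (⊥E d) = ⊥E (Der-map h s d)
Der-map h s (∧I d e) = ∧I (Der-map h s d) (Der-map h s e)
Der-map h s (∧E₁ d) = ∧E₁ (Der-map h s d)
Der-map h s (∧E₂ d) = ∧E₂ (Der-map h s d)
Der-map h s (∨I₁ d) = ∨I₁ (Der-map h s d)
Der-map h s (∨I₂ d) = ∨I₂ (Der-map h s d)
Der-map h s (∨E d e f) = ∨E (Der-map h s d) (Der-map h (∷⁺ʳ _ s) e) (Der-map h (∷⁺ʳ _ s) f)
Der-map h s (⇒I d) = ⇒I (Der-map h (∷⁺ʳ _ s) d)
Der-map h s (⇒E d e) = ⇒E (Der-map h s d) (Der-map h s e)
Der-map h s (∀I d) = ∀I (Der-map h (map⁺ wk s) d)
Der-map h s (∀E d t) = ∀E (Der-map h s d) t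
Der-map h s (∃I t d) = ∃I t (Der-map h s d)
Der-map h s (∃E d e) = ∃E (Der-map h s d) (Der-map h (∷⁺ʳ _ (map⁺ wk s)) e)
Der-map h s (eq-refl t) = eq-refl t
Der-map h s (eq-subst a d e) = eq-subst a (Der-map h s d) (Der-map h s e)
Der-map h s (S≠0 t) = S≠0 t
Der-map h s (S-inj t u) = S-inj t u
Der-map h s (ax-P i ts) = ax-P i ts
Der-map h s (ax-C f gs ts) = ax-C f gs ts
Der-map h s (ax-R0 f g ts) = ax-R0 f g ts
Der-map h s (ax-RS f g t ts) = ax-RS f g t ts
Der-map h s (ind a d e) = ind a (Der-map h s d) (Der-map h s e)

weaken : ∀ {A : Theory} {n} {Γ Δ : List (Formula n)} {φ} → Γ ⊆ Δ → Der A Γ φ → Der A Δ φ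
weaken = Der-map axm

cast : ∀ {A : Theory} {n} {Γ : List (Formula n)} {φ ψ} → φ ≡ ψ → Der A Γ φ → Der A Γ ψ
cast refl d = d

castΓ : ∀ {A : Theory} {n} {Γ Δ : List (Formula n)} {φ} → Γ ≡ Δ → Der A Γ φ → Der A Δ φ
castΓ refl d = d

SubClosed : Theory → Set
SubClosed A = ∀ {n m} (σ : Subst n m) (φ : Formula n) → A φ → A (sub σ φ)

subT-lookup : ∀ {n m k} (σ : Subst n m) (ts : Vec (Term n) k) i → subT σ (lookup ts i) ≡ lookup (subTs σ ts) i
subT-lookup σ (t ∷ ts) zero = refl
subT-lookup σ (t ∷ ts) (suc i) = subT-lookup σ ts i

subTs-map : ∀ {n m k l} (σ : Subst n m) (gs : Vec (PR k) l) (ts : Vec (Term n) k) →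
            subTs σ (Vec.map (λ g → app g ts) gs) ≡ Vec.map (λ g → app g (subTs σ ts)) gs
subTs-map σ [] ts = refl
subTs-map σ (g ∷ gs) ts = cong (app g (subTs σ ts) ∷_) (subTs-map σ gs ts)

Der-sub : ∀ {A : Theory} → SubClosed A → ∀ {n m} {Γ : List (Formula n)} {φ} (σ : Subst n m) →
          Der A Γ φ → Der A (map (sub σ) Γ) (sub σ φ)
Der-sub cl σ (hyp x) = hyp (∈-map⁺ (sub σ) x)
Der-sub cl σ (axm x) = axm (cl σ _ x)
Der-sub cl σ (⊥E d) = ⊥E (Der-sub cl σ d)
Der-sub cl σ (∧I d e) = ∧I (Der-sub cl σ d) (Der-sub cl σ e)
Der-sub cl σ (∧E₁ d) = ∧E₁ (Der-sub cl σ d)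
Der-sub cl σ (∧E₂ d) = ∧E₂ (Der-sub cl σ d)
Der-sub cl σ (∨I₁ d) = ∨I₁ (Der-sub cl σ d)
Der-sub cl σ (∨I₂ d) = ∨I₂ (Der-sub cl σ d)
Der-sub cl σ (∨E d e f) = ∨E (Der-sub cl σ d) (Der-sub cl σ e) (Der-sub cl σ f)
Der-sub cl σ (⇒I d) = ⇒I (Der-sub cl σ d)
Der-sub cl σ (⇒E d e) = ⇒E (Der-sub cl σ d) (Der-sub cl σ e)
Der-sub cl {Γ = Γ} σ (∀I d) = ∀I (castΓ (map-lift-wk σ Γ) (Der-sub cl (lift σ) d))
Der-sub cl σ (∀E {a = a} d t) = cast (sym (sub-inst σ a t)) (∀E (Der-sub cl σ d) (subT σ t))
Der-sub cl σ (∃I {a = a} t d) = ∃I (subT σ t) (cast (sub-inst σ a t) (Der-sub cl σ d))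
Der-sub cl {Γ = Γ} σ (∃E {c = c} d e) =
  ∃E (Der-sub cl σ d)
     (cast (lift-wk σ c) (castΓ (cong (_ ∷_) (map-lift-wk σ Γ)) (Der-sub cl (lift σ) e)))
Der-sub cl σ (eq-refl t) = eq-refl (subT σ t)
Der-sub cl σ (eq-subst a {t} {u} d e) =
  cast (sym (sub-inst σ a u))
    (eq-subst (sub (lift σ) a) (Der-sub cl σ d) (cast (sub-inst σ a t) (Der-sub cl σ e)))
Der-sub cl σ (S≠0 t) = S≠0 (subT σ t)
Der-sub cl σ (S-inj t u) = S-inj (subT σ t) (subT σ u)
Der-sub cl σ (ax-P i ts) = cast (cong (app (Pf i) (subTs σ ts) ≐_) (sym (subT-lookup σ ts i))) (ax-P i (subTs σ ts))
Der-sub cl σ (ax-C f gs ts) =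
  cast (cong (λ us → app (Cf f gs) (subTs σ ts) ≐ app f us) (sym (subTs-map σ gs ts))) (ax-C f gs (subTs σ ts))
Der-sub cl σ (ax-R0 f g ts) = ax-R0 f g (subTs σ ts)
Der-sub cl σ (ax-RS f g t ts) = ax-RS f g (subT σ t) (subTs σ ts)
Der-sub cl σ (ind a d e) =
  ind (sub (lift σ) a) (cast (sub-inst σ a 𝟎) (Der-sub cl σ d))
      (cast (cong (λ b → ∀' (sub (lift σ) a ⇒ b)) (sub-stepS σ a)) (Der-sub cl σ e))

SentAx-closed : ∀ S → SubClosed (SentAx S)
SentAx-closed S σ φ (ψ , s , refl) = ψ , s , sub-emb σ ψ

PA-closed : ∀ S → SubClosed (PA+ S)
PA-closed S σ φ (inj₁ (ψ , refl)) = inj₁ (sub σ ψ , refl)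
PA-closed S σ φ (inj₂ x) = inj₂ (SentAx-closed S σ φ x)

-- Derived rules, decidability and provable equivalence

module Logic (A : Theory) (cl : SubClosed A) where

  private variable
    n : ℕ
    Γ : List (Formula n)
    a b c d φ : Formula n

  v0 : Der A (a ∷ Γ) a
  v0 = hyp (here refl)

  v1 : Der A (b ∷ a ∷ Γ) a
  v1 = hyp (there (here refl))

  v2 : Der A (c ∷ b ∷ a ∷ Γ) a
  v2 = hyp (there (there (here refl)))

  v3 : Der A (d ∷ c ∷ b ∷ a ∷ Γ) a
  v3 = hyp (there (there (there (here refl))))

  ↑ : Der A Γ φ → Der A (a ∷ Γ) φ
  ↑ = weaken there

  closed : Der A [] φ → Der A Γ φ
  closed = weaken (λ ())

  ⇑ : Der A Γ φ → Der A (map wk Γ) (wk φ)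
  ⇑ = Der-sub cl (var ∘ suc)

  ∀E₀ : ∀ (a : Formula (suc n)) {Γ} → Der A Γ (wk (∀' a)) → Der A Γ a
  ∀E₀ a d = cast (wk-body a) (∀E d (var zero))

  ∃I₀ : ∀ (a : Formula (suc n)) {Γ} → Der A Γ a → Der A Γ (wk (∃' a))
  ∃I₀ a d = ∃I (var zero) (cast (sym (wk-body a)) d)

  cut : Der A Γ a → Der A (a ∷ Γ) b → Der A Γ b
  cut d e = ⇒E (⇒I e) d

  Dec : Formula n → Set
  Dec φ = Der A [] (φ ∨' ~ φ)

  Dec-wk : ∀ (φ : Formula n) → Dec φ → Dec (wk φ)
  Dec-wk φ d = Der-sub cl (var ∘ suc) d

  dec-∧ : Der A Γ (a ∨' ~ a) → Der A Γ (b ∨' ~ b) → Der A Γ (a ∧' b ∨' ~ (a ∧' b))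
  dec-∧ d e = ∨E d (∨E (↑ e) (∨I₁ (∧I v1 v0)) (∨I₂ (⇒I (⇒E v1 (∧E₂ v0))))) (∨I₂ (⇒I (⇒E v1 (∧E₁ v0))))

  dec-∨ : Der A Γ (a ∨' ~ a) → Der A Γ (b ∨' ~ b) → Der A Γ ((a ∨' b) ∨' ~ (a ∨' b))
  dec-∨ d e = ∨E d (∨I₁ (∨I₁ v0)) (∨E (↑ e) (∨I₁ (∨I₂ v0)) (∨I₂ (⇒I (∨E v0 (⇒E v3 v0) (⇒E v2 v0)))))

  dec-⇒ : Der A Γ (a ∨' ~ a) → Der A Γ (b ∨' ~ b) → Der A Γ ((a ⇒ b) ∨' ~ (a ⇒ b))
  dec-⇒ d e = ∨E d (∨E (↑ e) (∨I₁ (⇒I v1)) (∨I₂ (⇒I (⇒E v1 (⇒E v0 v2))))) (∨I₁ (⇒I (⊥E (⇒E v1 v0))))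

  eq-cong : ∀ {t u : Term n} (s : Term (suc n)) → Der A Γ (t ≐ u) → Der A Γ (subT (inst t) s ≐ subT (inst u) s)
  eq-cong {Γ = Γ} {t = t} {u} s d =
    cast (cong₂ _≐_ (subT-inst-renT u _) refl) (cast ([]-inst body u)
      (eq-subst body d (cast (sym ([]-inst body t)) (cast (cong₂ _≐_ (sym (subT-inst-renT t _)) refl) (eq-refl _)))))
    where
    body : Formula _
    body = renT suc (subT (inst t) s) ≐ s

  eq-sym : ∀ {t u : Term n} → Der A Γ (t ≐ u) → Der A Γ (u ≐ t)
  eq-sym {t = t} {u} d =
    cast (trans ([]-inst body u) (cong (u ≐_) (subT-inst-renT u t)))
      (eq-subst body d (cast (sym (trans ([]-inst body t) (cong (t ≐_) (subT-inst-renT t t)))) (eq-refl t)))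
    where
    body : Formula _
    body = var zero ≐ renT suc t

  eq-trans : ∀ {t u w : Term n} → Der A Γ (t ≐ u) → Der A Γ (u ≐ w) → Der A Γ (t ≐ w)
  eq-trans {t = t} {u} {w} d e =
    cast (trans ([]-inst body w) (cong (_≐ w) (subT-inst-renT w t)))
      (eq-subst body e (cast (sym (trans ([]-inst body u) (cong (_≐ u) (subT-inst-renT u t)))) d))
    where
    body : Formula _
    body = renT suc t ≐ var zero

  eq-S : ∀ {t u : Term n} → Der A Γ (t ≐ u) → Der A Γ (𝐒 t ≐ 𝐒 u)
  eq-S = eq-cong (𝐒 (var zero))

  -- Induction on the first number, with the second one universally quantified. The inner inductions
  -- are case distinctions on the second number; two successors reduce to the outer hypothesis at
  -- the predecessor.
  eq-dec-∀ : Der A {n} Γ (∀' (∀' (var (suc zero) ≐ var zero ∨' ~ (var (suc zero) ≐ var zero))))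
  eq-dec-∀ =
    ind (∀' (var (suc zero) ≐ var zero ∨' ~ (var (suc zero) ≐ var zero)))
      (ind (𝟎 ≐ var zero ∨' ~ (𝟎 ≐ var zero)) (∨I₁ (eq-refl _))
        (∀I (⇒I (∨I₂ (⇒I (⇒E (S≠0 _) (eq-sym v0)))))))
      (∀I (⇒I (ind (𝐒 (var (suc zero)) ≐ var zero ∨' ~ (𝐒 (var (suc zero)) ≐ var zero)) (∨I₂ (S≠0 _))
        (∀I (⇒I (∨E (∀E v1 (var zero))
          (∨I₁ (eq-S v0))
          (∨I₂ (⇒I (⇒E v1 (⇒E (S-inj _ _) v0))))))))))

  eq-dec : ∀ (t u : Term n) → Der A Γ (t ≐ u ∨' ~ (t ≐ u))
  eq-dec t u = cast (cong (λ s → s ≐ u ∨' ~ (s ≐ u)) (subT-inst-renT u t))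
    (cast ([]-inst (renT suc t ≐ var zero ∨' ~ (renT suc t ≐ var zero)) u) (∀E (∀E eq-dec-∀ t) u))

  QF-dec : QF φ → Der A Γ (φ ∨' ~ φ)
  QF-dec (qf-eq {t = t} {u}) = eq-dec t u
  QF-dec qf-⊥ = ∨I₂ (⇒I v0)
  QF-dec (qf-∧ p q) = dec-∧ (QF-dec p) (QF-dec q)
  QF-dec (qf-∨ p q) = dec-∨ (QF-dec p) (QF-dec q)
  QF-dec (qf-⇒ p q) = dec-⇒ (QF-dec p) (QF-dec q)

  infix 3 _⟺_
  _⟺_ : Formula n → Formula n → Set
  φ ⟺ ψ = Der A [] (φ ⇒ ψ) × Der A [] (ψ ⇒ φ)

  ⟺-refl : φ ⟺ φ
  ⟺-refl = ⇒I v0 , ⇒I v0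

  ⟺-trans : a ⟺ b → b ⟺ c → a ⟺ c
  ⟺-trans (f , f') (g , g') = ⇒I (⇒E (↑ g) (⇒E (↑ f) v0)) , ⇒I (⇒E (↑ f') (⇒E (↑ g') v0))

  ∧-mono : Der A [] (a ⇒ c) → Der A [] (b ⇒ d) → Der A [] (a ∧' b ⇒ c ∧' d)
  ∧-mono f g = ⇒I (∧I (⇒E (↑ f) (∧E₁ v0)) (⇒E (↑ g) (∧E₂ v0)))

  ∨-mono : Der A [] (a ⇒ c) → Der A [] (b ⇒ d) → Der A [] (a ∨' b ⇒ c ∨' d)
  ∨-mono f g = ⇒I (∨E v0 (∨I₁ (⇒E (closed f) v0)) (∨I₂ (⇒E (closed g) v0)))

  ∀-mono : Der A [] (a ⇒ b) → Der A [] (∀' a ⇒ ∀' b)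
  ∀-mono {a = a} f = ⇒I (∀I (⇒E (↑ f) (∀E₀ a v0)))

  ∃-mono : Der A [] (a ⇒ b) → Der A [] (∃' a ⇒ ∃' b)
  ∃-mono {b = b} f = ⇒I (∃E v0 (∃I₀ b (⇒E (closed f) v0)))

  ∧-cong : a ⟺ c → b ⟺ d → a ∧' b ⟺ c ∧' d
  ∧-cong (f , f') (g , g') = ∧-mono f g , ∧-mono f' g'

  ∨-cong : a ⟺ c → b ⟺ d → a ∨' b ⟺ c ∨' d
  ∨-cong (f , f') (g , g') = ∨-mono f g , ∨-mono f' g'

  ⇒-cong : a ⟺ c → b ⟺ d → (a ⇒ b) ⟺ (c ⇒ d)
  ⇒-cong (f , f') (g , g') =
    ⇒I (⇒I (⇒E (closed g) (⇒E v1 (⇒E (closed f') v0)))) , ⇒I (⇒I (⇒E (closed g') (⇒E v1 (⇒E (closed f) v0))))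

  ∧-swap : a ∧' b ⟺ b ∧' a
  ∧-swap = ⇒I (∧I (∧E₂ v0) (∧E₁ v0)) , ⇒I (∧I (∧E₂ v0) (∧E₁ v0))

  ∨-swap : a ∨' b ⟺ b ∨' a
  ∨-swap = ⇒I (∨E v0 (∨I₂ v0) (∨I₁ v0)) , ⇒I (∨E v0 (∨I₂ v0) (∨I₁ v0))

  ∃∧-pull : ∃' a ∧' b ⟺ ∃' (a ∧' wk b)
  ∃∧-pull {a = a} {b = b} =
    ⇒I (∃E (∧E₁ v0) (∃I₀ (a ∧' wk b) (∧I v0 (∧E₂ v1)))) ,
    ⇒I (∃E v0 (∧I (∃I₀ a (∧E₁ v0)) (∧E₂ v0)))

  ∃∨-pull : ∃' a ∨' b ⟺ ∃' (a ∨' wk b)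
  ∃∨-pull {a = a} {b = b} =
    ⇒I (∨E v0 (∃E v0 (∃I₀ (a ∨' wk b) (∨I₁ v0))) (∃I 𝟎 (∨I₂ (cast (sym (wk-inst b 𝟎)) v0)))) ,
    ⇒I (∃E v0 (∨E v0 (∨I₁ (∃I₀ a v0)) (∨I₂ v0)))

  ∀∧-pull : ∀' a ∧' b ⟺ ∀' (a ∧' wk b)
  ∀∧-pull {a = a} {b = b} =
    ⇒I (∀I (∧I (∀E₀ a (∧E₁ v0)) (∧E₂ v0))) ,
    ⇒I (∧I (∀I (∧E₁ (∀E₀ (a ∧' wk b) v0))) (cast (wk-inst b 𝟎) (∧E₂ (∀E v0 𝟎))))

  -- From right to left this is the constant-domain principle, which deciding `b` before the
  -- universal quantifier makes intuitionistic.
  ∀∨-pull : Dec b → ∀' a ∨' b ⟺ ∀' (a ∨' wk b)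
  ∀∨-pull {b = b} {a = a} dec =
    ⇒I (∨E v0 (∀I (∨I₁ (∀E₀ a v0))) (∀I (∨I₂ v0))) ,
    ⇒I (∨E (closed dec) (∨I₂ v0)
      (∨I₁ (∀I (∨E (∀E₀ (a ∨' wk b) v1) v0 (⊥E (⇒E v1 v0))))))

  Dec-⟺ : a ⟺ b → Dec b → Dec a
  Dec-⟺ (f , g) d = ∨E d (∨I₁ (⇒E (↑ g) v0)) (∨I₂ (⇒I (⇒E v1 (⇒E (closed f) v0))))

  -- Intuitionistically valid for every formula; excluded middle is paid for only in the opposite
  -- direction, by `Sig-¬⇒dual`.
  dual⇒¬ : ∀ (φ : Formula n) {Γ} → Der A Γ (dual φ ⇒ ~ φ)
  dual⇒¬ (t ≐ u) = ⇒I v0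
  dual⇒¬ ⊥' = ⇒I v0
  dual⇒¬ (a ∧' b) = ⇒I v0
  dual⇒¬ (a ∨' b) = ⇒I v0
  dual⇒¬ (a ⇒ b) = ⇒I v0
  dual⇒¬ (∀' a) = ⇒I (⇒I (∃E v1 (⇒E (⇒E (dual⇒¬ a) v0) (∀E₀ a v1))))
  dual⇒¬ (∃' a) = ⇒I (⇒I (∃E v0 (⇒E (⇒E (dual⇒¬ a) (∀E₀ (dual a) v2)) v0)))

-- The arithmetical hierarchy

QF-sub : ∀ {n m} (σ : Subst n m) {φ} → QF φ → QF (sub σ φ)
QF-sub σ qf-eq = qf-eq
QF-sub σ qf-⊥ = qf-⊥
QF-sub σ (qf-∧ p q) = qf-∧ (QF-sub σ p) (QF-sub σ q)
QF-sub σ (qf-∨ p q) = qf-∨ (QF-sub σ p) (QF-sub σ q)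
QF-sub σ (qf-⇒ p q) = qf-⇒ (QF-sub σ p) (QF-sub σ q)

mutual
  Sig-sub : ∀ k {n m} (σ : Subst n m) {φ} → Sig k φ → Sig k (sub σ φ)
  Sig-sub zero σ p = QF-sub σ p
  Sig-sub (suc k) σ (ex-base p) = ex-base (Pi-sub k σ p)
  Sig-sub (suc k) σ (ex-step p) = ex-step (Sig-sub (suc k) (lift σ) p)

  Pi-sub : ∀ k {n m} (σ : Subst n m) {φ} → Pi k φ → Pi k (sub σ φ)
  Pi-sub zero σ p = QF-sub σ p
  Pi-sub (suc k) σ (all-base p) = all-base (Sig-sub k σ p)
  Pi-sub (suc k) σ (all-step p) = all-step (Pi-sub (suc k) (lift σ) p)

mutual
  QF⇒Sig : ∀ k {n} {φ : Formula n} → QF φ → Sig k φ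
  QF⇒Sig zero p = p
  QF⇒Sig (suc k) p = ex-base (QF⇒Pi k p)

  QF⇒Pi : ∀ k {n} {φ : Formula n} → QF φ → Pi k φ
  QF⇒Pi zero p = p
  QF⇒Pi (suc k) p = all-base (QF⇒Sig k p)

mutual
  Sig-suc : ∀ k {n} {φ : Formula n} → Sig k φ → Sig (suc k) φ
  Sig-suc zero p = ex-base p
  Sig-suc (suc k) (ex-base p) = ex-base (Pi-suc k p)
  Sig-suc (suc k) (ex-step p) = ex-step (Sig-suc (suc k) p)

  Pi-suc : ∀ k {n} {φ : Formula n} → Pi k φ → Pi (suc k) φ
  Pi-suc zero p = all-base p
  Pi-suc (suc k) (all-base p) = all-base (Sig-suc k p)
  Pi-suc (suc k) (all-step p) = all-step (Pi-suc (suc k) p)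

Sig-mono : ∀ {j k} → j ≤ k → ∀ {n} {φ : Formula n} → Sig j φ → Sig k φ
Sig-mono {k = k} z≤n p = QF⇒Sig k p
Sig-mono (s≤s {n = k} j≤k) (ex-base p) = ex-base (Pi-mono j≤k p)
  where
  Pi-mono : ∀ {j k} → j ≤ k → ∀ {n} {φ : Formula n} → Pi j φ → Pi k φ
  Pi-mono {k = k} z≤n p = QF⇒Pi k p
  Pi-mono (s≤s j≤k) (all-base p) = all-base (Sig-mono j≤k p)
  Pi-mono (s≤s j≤k) (all-step p) = all-step (Pi-mono (s≤s j≤k) p)
Sig-mono (s≤s j≤k) (ex-step p) = ex-step (Sig-mono (s≤s j≤k) p)

QF-dual : ∀ {n} {φ : Formula n} → QF φ → dual φ ≡ ~ φ
QF-dual qf-eq = refl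
QF-dual qf-⊥ = refl
QF-dual (qf-∧ p q) = refl
QF-dual (qf-∨ p q) = refl
QF-dual (qf-⇒ p q) = refl

QF-dual-QF : ∀ {n} {φ : Formula n} → QF φ → QF (dual φ)
QF-dual-QF p = subst QF (sym (QF-dual p)) (qf-⇒ p qf-⊥)

mutual
  Sig-dual : ∀ k {n} {φ : Formula n} → Sig k φ → Pi k (dual φ)
  Sig-dual zero p = QF-dual-QF p
  Sig-dual (suc k) (ex-base p) = all-base (Pi-dual k p)
  Sig-dual (suc k) (ex-step p) = all-step (Sig-dual (suc k) p)

  Pi-dual : ∀ k {n} {φ : Formula n} → Pi k φ → Sig k (dual φ)
  Pi-dual zero p = QF-dual-QF p
  Pi-dual (suc k) (all-base p) = ex-base (Sig-dual k p)
  Pi-dual (suc k) (all-step p) = ex-step (Pi-dual (suc k) p)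

-- Degrees

-- Bounded plus j is E_{j+1} ∪ F_j^+, and Bounded minus j is its dual.
Bounded : Sign → ℕ → FClass
Bounded s j φ = All (λ p → length (pre s p) ≤ suc j) (Alt φ)

Degree≤ : ℕ → FClass
Degree≤ k φ = All (λ p → length p ≤ k) (Alt φ)

Degree≤⇒F⁺ : ∀ {n} (φ : Formula n) {k} → Degree≤ k φ → F⁺ k φ
Degree≤⇒F⁺ φ = go (Alt φ)
  where
  go : ∀ ps {k} → All (λ p → length p ≤ k) ps → foldr (λ p m → length p ⊔ m) 0 ps ≤ k
  go [] [] = z≤n
  go (p ∷ ps) (q ∷ qs) = ⊔-lub q (go ps qs)

F⁺⇒Degree≤ : ∀ {n} (φ : Formula n) {k} → F⁺ k φ → Degree≤ k φ
F⁺⇒Degree≤ φ = go (Alt φ)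
  where
  go : ∀ (ps : List Path) {k} → foldr (λ p m → length p ⊔ m) 0 ps ≤ k → All (λ p → length p ≤ k) ps
  go [] h = []
  go (p ∷ ps) h = m⊔n≤o⇒m≤o (length p) _ h ∷ go ps (m⊔n≤o⇒n≤o (length p) _ h)

-- Excludes a vacuous `All`, so that a quantified formula really has positive degree
-- (`degree-quant-zero`).
Alt-nonempty : ∀ {n} (φ : Formula n) {P : Path → Set} → All P (Alt φ) → ∃ P
Alt-nonempty (t ≐ u) (p ∷ _) = _ , p
Alt-nonempty ⊥' (p ∷ _) = _ , p
Alt-nonempty (a ∧' b) h = Alt-nonempty a (Allₚ.++⁻ˡ (Alt a) h)
Alt-nonempty (a ∨' b) h = Alt-nonempty a (Allₚ.++⁻ˡ (Alt a) h)
Alt-nonempty (a ⇒ b) h with p , q ← Alt-nonempty a (Allₚ.map⁻ (Allₚ.++⁻ˡ (map flipP (Alt a)) h)) = _ , q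
Alt-nonempty (∀' a) h with p , q ← Alt-nonempty a (Allₚ.map⁻ h) = _ , q
Alt-nonempty (∃' a) h with p , q ← Alt-nonempty a (Allₚ.map⁻ h) = _ , q

pre-idem : ∀ s p → length (pre s (pre s p)) ≡ length (pre s p)
pre-idem plus [] = refl
pre-idem plus (plus ∷ p) = refl
pre-idem plus (minus ∷ p) = refl
pre-idem minus [] = refl
pre-idem minus (plus ∷ p) = refl
pre-idem minus (minus ∷ p) = refl

pre-alt : ∀ s p → length (pre (flipS s) (pre s p)) ≡ suc (length (pre s p))
pre-alt plus [] = refl
pre-alt plus (plus ∷ p) = refl
pre-alt plus (minus ∷ p) = refl
pre-alt minus [] = refl
pre-alt minus (plus ∷ p) = refl
pre-alt minus (minus ∷ p) = refl

length-flipP : ∀ p → length (flipP p) ≡ length p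
length-flipP [] = refl
length-flipP (s ∷ p) = cong suc (length-flipP p)

pre-flip : ∀ s p → length (pre s (flipP p)) ≡ length (pre (flipS s) p)
pre-flip plus [] = refl
pre-flip plus (plus ∷ p) = cong (λ l → suc (suc l)) (length-flipP p)
pre-flip plus (minus ∷ p) = cong suc (length-flipP p)
pre-flip minus [] = refl
pre-flip minus (plus ∷ p) = cong suc (length-flipP p)
pre-flip minus (minus ∷ p) = cong (λ l → suc (suc l)) (length-flipP p)

pre-nonempty : ∀ s p → 1 ≤ length (pre s p)
pre-nonempty plus [] = s≤s z≤n
pre-nonempty plus (plus ∷ p) = s≤s z≤n
pre-nonempty plus (minus ∷ p) = s≤s z≤n
pre-nonempty minus [] = s≤s z≤n
pre-nonempty minus (plus ∷ p) = s≤s z≤n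
pre-nonempty minus (minus ∷ p) = s≤s z≤n

pre-≤ : ∀ s p → length (pre s p) ≤ suc (length p)
pre-≤ plus [] = ≤-refl
pre-≤ plus (plus ∷ p) = n≤1+n _
pre-≤ plus (minus ∷ p) = ≤-refl
pre-≤ minus [] = ≤-refl
pre-≤ minus (plus ∷ p) = ≤-refl
pre-≤ minus (minus ∷ p) = n≤1+n _

pre-≥ : ∀ s p → length p ≤ length (pre s p)
pre-≥ plus [] = z≤n
pre-≥ plus (plus ∷ p) = ≤-refl
pre-≥ plus (minus ∷ p) = n≤1+n _
pre-≥ minus [] = z≤n
pre-≥ minus (plus ∷ p) = n≤1+n _
pre-≥ minus (minus ∷ p) = ≤-refl

bounded-⇒ : ∀ {n} s {j} {a b : Formula n} → Bounded s j (a ⇒ b) → Bounded (flipS s) j a × Bounded s j b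
bounded-⇒ s {j} {a} h =
  All.map (λ {p} → subst (_≤ suc j) (pre-flip s p)) (Allₚ.map⁻ (Allₚ.++⁻ˡ (map flipP (Alt a)) h)) ,
  Allₚ.++⁻ʳ (map flipP (Alt a)) h

degree-⇒ : ∀ {n k} {a b : Formula n} → Degree≤ k (a ⇒ b) → Degree≤ k a × Degree≤ k b
degree-⇒ {k = k} {a} h =
  All.map (λ {p} → subst (_≤ k) (length-flipP p)) (Allₚ.map⁻ (Allₚ.++⁻ˡ (map flipP (Alt a)) h)) ,
  Allₚ.++⁻ʳ (map flipP (Alt a)) h

quant : Sign → ∀ {n} → Formula (suc n) → Formula n
quant plus = ∃'
quant minus = ∀'

Alt-quant : ∀ s {n} (a : Formula (suc n)) → Alt (quant s a) ≡ map (pre s) (Alt a)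
Alt-quant plus a = refl
Alt-quant minus a = refl

bounded-same : ∀ s {n j} (a : Formula (suc n)) → Bounded s j (quant s a) → Bounded s j a
bounded-same s {j = j} a h =
  All.map (λ {p} → subst (_≤ suc j) (pre-idem s p)) (Allₚ.map⁻ (subst (All _) (Alt-quant s a) h))

-- Every path of `quant s a` starts with `s`, so prefixing the opposite sign makes it longer by one;
-- the bound `suc j` for the prefixed path is the bound `j` for the path itself.
bounded-alt : ∀ s {n j} (a : Formula (suc n)) → Bounded (flipS s) j (quant s a) → Degree≤ j (quant s a)
bounded-alt s {j = j} a h =
  subst (All _) (sym (Alt-quant s a)) (Allₚ.map⁺ (All.map (λ {p} → pred-≤ p) (Allₚ.map⁻ (subst (All _) (Alt-quant s a) h))))
  where
  pred-≤ : ∀ p → length (pre (flipS s) (pre s p)) ≤ suc j → length (pre s p) ≤ j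
  pred-≤ p q with s≤s r ← subst (_≤ suc j) (pre-alt s p) q = r

degree-quant : ∀ s {n j} (a : Formula (suc n)) → Degree≤ (suc j) (quant s a) → Bounded s j a
degree-quant s a h = Allₚ.map⁻ (subst (All _) (Alt-quant s a) h)

quant-degree : ∀ s {n j} (a : Formula (suc n)) → Bounded s j a → Bounded s j (quant s a)
quant-degree s {j = j} a h =
  subst (All _) (sym (Alt-quant s a)) (Allₚ.map⁺ (All.map (λ {p} → subst (_≤ suc j) (sym (pre-idem s p))) h))

degree-quant-zero : ∀ s {n} (a : Formula (suc n)) → Degree≤ 0 (quant s a) → ⊥
degree-quant-zero s a h with p , q ← Alt-nonempty a (Allₚ.map⁻ (subst (All _) (Alt-quant s a) h))
  with ≤-trans (pre-nonempty s p) q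
... | ()

degree-body : ∀ s {n k} (a : Formula (suc n)) → Degree≤ k (quant s a) → Degree≤ k a
degree-body s a h = All.map (λ {p} → ≤-trans (pre-≥ s p)) (Allₚ.map⁻ (subst (All _) (Alt-quant s a) h))

bounded⇒degree : ∀ s {n j} (φ : Formula n) → Bounded s j φ → Degree≤ (suc j) φ
bounded⇒degree s φ = All.map (λ {p} → ≤-trans (pre-≥ s p))

degree⇒bounded : ∀ s {n j} (φ : Formula n) → Degree≤ j φ → Bounded s j φ
degree⇒bounded s φ = All.map (λ {p} q → ≤-trans (pre-≤ s p) (s≤s q))

degree-~ : ∀ {n k} (a : Formula n) → Degree≤ k a → Degree≤ k (~ a)
degree-~ {k = k} a h = Allₚ.++⁺ (Allₚ.map⁺ (All.map (λ {p} → subst (_≤ k) (sym (length-flipP p))) h)) (z≤n ∷ [])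

-- Negation and the change of quantifier flip signs consistently, which preserves lengths. The path
-- contributed by `⊥'` becomes a single plus, hence the separate case of degree 0.
degree-∃~ : ∀ {n k} (a : Formula (suc n)) → Degree≤ k (∀' a) → Degree≤ k (∃' (~ a))
degree-∃~ {k = zero} a h = ⊥-elim (degree-quant-zero minus a h)
degree-∃~ {k = suc k} a h =
  Allₚ.map⁺ (Allₚ.++⁺ (Allₚ.map⁺ (All.map (λ {p} → subst (_≤ suc k) (sym (pre-flip plus p))) (Allₚ.map⁻ h))) (s≤s z≤n ∷ []))

QF-degree : ∀ {n k} {φ : Formula n} → QF φ → Degree≤ k φ
QF-degree qf-eq = z≤n ∷ []
QF-degree qf-⊥ = z≤n ∷ []
QF-degree (qf-∧ p q) = Allₚ.++⁺ (QF-degree p) (QF-degree q)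
QF-degree (qf-∨ p q) = Allₚ.++⁺ (QF-degree p) (QF-degree q)
QF-degree {k = k} (qf-⇒ p q) =
  Allₚ.++⁺ (Allₚ.map⁺ (All.map (λ {s} → subst (_≤ k) (sym (length-flipP s))) (QF-degree p))) (QF-degree q)

mutual
  Sig-bounded : ∀ k {n} {φ : Formula n} → Sig (suc k) φ → Bounded plus k φ
  Sig-bounded k {φ = φ} (ex-base p) = degree⇒bounded plus φ (Pi-degree k p)
  Sig-bounded k (ex-step {φ = a} p) = quant-degree plus a (Sig-bounded k p)

  Pi-bounded : ∀ k {n} {φ : Formula n} → Pi (suc k) φ → Bounded minus k φ
  Pi-bounded k {φ = φ} (all-base p) = degree⇒bounded minus φ (Sig-degree k p)
  Pi-bounded k (all-step {φ = a} p) = quant-degree minus a (Pi-bounded k p)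

  Sig-degree : ∀ k {n} {φ : Formula n} → Sig k φ → Degree≤ k φ
  Sig-degree zero p = QF-degree p
  Sig-degree (suc k) {φ = φ} p = bounded⇒degree plus φ (Sig-bounded k p)

  Pi-degree : ∀ k {n} {φ : Formula n} → Pi k φ → Degree≤ k φ
  Pi-degree zero p = QF-degree p
  Pi-degree (suc k) {φ = φ} p = bounded⇒degree minus φ (Pi-bounded k p)

E-suc⇒Bounded : ∀ k {n} (φ : Formula n) → E-suc k φ → Bounded plus k φ
E-suc⇒Bounded k φ (f , h) =
  All.zipWith (λ {p} → λ { (q , r) → step p q r }) (F⁺⇒Degree≤ φ (subst (deg φ ≤_) f ≤-refl) , h)
  where
  step : ∀ p → length p ≤ suc k → (length p ≡ suc k → head p ≡ just plus) → length (pre plus p) ≤ suc k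
  step [] q r = s≤s z≤n
  step (plus ∷ p) q r = q
  step (minus ∷ p) (s≤s q) r with m≤n⇒m<n∨m≡n q
  ... | inj₁ l = s≤s l
  ... | inj₂ e with () ← r (cong suc e)

mutual
  -- The one connective without a generating clause for 𝓙 is ∀, and there `bounded-alt` has already
  -- brought the degree down to `k`. An implication exchanges 𝓙 and 𝓡 exactly as it flips the sign.
  Bounded⇒J⁺ : ∀ k {n} (φ : Formula n) → Bounded plus k φ → J⁺ k φ
  Bounded⇒J⁺ k (t ≐ u) h = J-base z≤n
  Bounded⇒J⁺ k ⊥' h = J-base z≤n
  Bounded⇒J⁺ k (a ∧' b) h = J-∧ (Bounded⇒J⁺ k a (Allₚ.++⁻ˡ (Alt a) h)) (Bounded⇒J⁺ k b (Allₚ.++⁻ʳ (Alt a) h))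
  Bounded⇒J⁺ k (a ∨' b) h = J-∨ (Bounded⇒J⁺ k a (Allₚ.++⁻ˡ (Alt a) h)) (Bounded⇒J⁺ k b (Allₚ.++⁻ʳ (Alt a) h))
  Bounded⇒J⁺ k (a ⇒ b) h with h₁ , h₂ ← bounded-⇒ plus {a = a} {b} h = J-⇒ (Bounded⇒R⁺ k a h₁) (Bounded⇒J⁺ k b h₂)
  Bounded⇒J⁺ k (∀' a) h = J-base (Degree≤⇒F⁺ (∀' a) (bounded-alt minus a h))
  Bounded⇒J⁺ k (∃' a) h = J-∃ (Bounded⇒J⁺ k a (bounded-same plus a h))

  Bounded⇒R⁺ : ∀ k {n} (φ : Formula n) → Bounded minus k φ → R⁺ k φ
  Bounded⇒R⁺ k (t ≐ u) h = R-base z≤n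
  Bounded⇒R⁺ k ⊥' h = R-base z≤n
  Bounded⇒R⁺ k (a ∧' b) h = R-∧ (Bounded⇒R⁺ k a (Allₚ.++⁻ˡ (Alt a) h)) (Bounded⇒R⁺ k b (Allₚ.++⁻ʳ (Alt a) h))
  Bounded⇒R⁺ k (a ∨' b) h = R-∨ (Bounded⇒R⁺ k a (Allₚ.++⁻ˡ (Alt a) h)) (Bounded⇒R⁺ k b (Allₚ.++⁻ʳ (Alt a) h))
  Bounded⇒R⁺ k (a ⇒ b) h with h₁ , h₂ ← bounded-⇒ minus {a = a} {b} h = R-⇒ (Bounded⇒J⁺ k a h₁) (Bounded⇒R⁺ k b h₂)
  Bounded⇒R⁺ k (∀' a) h = R-∀ (Bounded⇒R⁺ k a (bounded-same minus a h))
  Bounded⇒R⁺ k (∃' a) h = R-base (Degree≤⇒F⁺ (∃' a) (bounded-alt plus a h))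

Sig⇒J⁺ : ∀ k {n} {φ : Formula n} → Sig (suc k) φ → J⁺ k φ
Sig⇒J⁺ k p = Bounded⇒J⁺ k _ (Sig-bounded k p)

Pi⇒V⁺ : ∀ k {n} {φ : Formula n} → Pi (suc (suc k)) φ → V⁺ k φ
Pi⇒V⁺ k (all-base p) = V-base (Sig⇒J⁺ k p)
Pi⇒V⁺ k (all-step p) = V-∀ (Pi⇒V⁺ k p)

-- Prenex forms and decidability under excluded middle

module Prenex (A : Theory) (cl : SubClosed A) where

  open Logic A cl

  private variable
    n m : ℕ
    Γ : List (Formula n)
    a b φ ψ : Formula n

  -- The bound is strict, so LEM(Σ_m) with all lower levels is `LEM< (suc m)`, and level 0 can be
  -- treated without any hypothesis.
  LEM< : ℕ → Set
  LEM< m = ∀ {i} → i < m → ProvesLEM (Sig i) A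

  LEM<-pred : LEM< (suc m) → LEM< m
  LEM<-pred L i<m = L (m<n⇒m<1+n i<m)

  LEM-induction : ∀ k → (∀ j → suc j ≤ k → LEM< (suc j) → ProvesLEM (Sig (suc j)) A) → ProvesLEM (Sig k) A
  LEM-induction k step = go k ≤-refl (n<1+n k)
    where
    go : ∀ j → j ≤ k → LEM< (suc j)
    go zero j≤k {zero} _ φ p = QF-dec p
    go zero j≤k {suc i} (s≤s ())
    go (suc j) j≤k (s≤s i≤j) with m≤n⇒m<n∨m≡n i≤j
    ... | inj₁ i<j = go j (≤-trans (n≤1+n j) j≤k) i<j
    ... | inj₂ refl = step j j≤k (go j (≤-trans (n≤1+n j) j≤k))

  mutual
    Sig-∨-dual : ∀ m → LEM< (suc m) → Sig m φ → Der A Γ (φ ∨' dual φ)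
    Sig-∨-dual zero L p = cast (cong (_ ∨'_) (sym (QF-dual p))) (QF-dec p)
    Sig-∨-dual (suc m) L p =
      ∨E (closed (L (n<1+n (suc m)) _ p)) (∨I₁ v0) (∨I₂ (⇒E (Sig-¬⇒dual m (LEM<-pred L) p) v0))

    Pi-∨-dual : ∀ m → LEM< (suc m) → Pi m φ → Der A Γ (φ ∨' dual φ)
    Pi-∨-dual zero L p = cast (cong (_ ∨'_) (sym (QF-dual p))) (QF-dec p)
    Pi-∨-dual (suc m) L p =
      ∨E (closed (L (n<1+n (suc m)) _ (Pi-dual (suc m) p))) (∨I₂ v0) (∨I₁ (⇒E (Pi-¬dual⇒ m (LEM<-pred L) p) v0))

    -- Costs one level less than deciding φ: the negation passes through the ∃-block
    -- intuitionistically, and only the Π_m matrix is decided.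
    Sig-¬⇒dual : ∀ m → LEM< (suc m) → Sig (suc m) φ → Der A Γ (~ φ ⇒ dual φ)
    Sig-¬⇒dual m L (ex-base p) = ⇒I (∨E (Pi-∨-dual m L p) (⊥E (⇒E v1 v0)) v0)
    Sig-¬⇒dual m L (ex-step {φ = a} p) = ⇒I (∀I (⇒E (Sig-¬⇒dual m L p) (⇒I (⇒E v1 (∃I₀ a v0)))))

    Pi-¬dual⇒ : ∀ m → LEM< (suc m) → Pi (suc m) φ → Der A Γ (~ dual φ ⇒ φ)
    Pi-¬dual⇒ m L (all-base p) = ⇒I (∨E (Sig-∨-dual m L p) v0 (⊥E (⇒E v1 v0)))
    Pi-¬dual⇒ m L (all-step {φ = a} p) = ⇒I (∀I (⇒E (Pi-¬dual⇒ m L p) (⇒I (⇒E v1 (∃I₀ (dual a) v0)))))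

  ∨-dual⇒Dec : Der A [] (φ ∨' dual φ) → Dec φ
  ∨-dual⇒Dec {φ = φ} d = ∨E d (∨I₁ v0) (∨I₂ (⇒E (dual⇒¬ φ) v0))

  Pi-dec : ∀ m → LEM< (suc m) → Pi m φ → Dec φ
  Pi-dec m L p = ∨-dual⇒Dec (Pi-∨-dual m L p)

  Eqv : (Formula n → Set) → Formula n → Set
  Eqv {n} P φ = Σ (Formula n) (λ ψ → P ψ × φ ⟺ ψ)

  Eqv-⟺ : ∀ {P : Formula n → Set} → φ ⟺ ψ → Eqv P ψ → Eqv P φ
  Eqv-⟺ e (χ , p , f) = χ , p , ⟺-trans e f

  Eqv-∃ : ∀ {P : FClass} → Eqv (ExBlock P) φ → Eqv (ExBlock P) (∃' φ)
  Eqv-∃ (χ , p , f , g) = ∃' χ , ex-step p , ∃-mono f , ∃-mono g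

  Eqv-∀ : ∀ {P : FClass} → Eqv (AllBlock P) φ → Eqv (AllBlock P) (∀' φ)
  Eqv-∀ (χ , p , f , g) = ∀' χ , all-step p , ∀-mono f , ∀-mono g

  Connective : Set
  Connective = ∀ {n} → Formula n → Formula n → Formula n

  WkClosed : FClass → Set
  WkClosed P = ∀ {n} {φ : Formula n} → P φ → P (wk φ)

  -- Empties the quantifier block of the left argument; the block on the right is reached by
  -- swapping the arguments in `base`. `Q` collects what the right argument must satisfy at each
  -- pull, and it has to survive weakening because every pull adds a variable. In `pull-∀` for ∨ it
  -- includes decidability.
  pull-∃ : ∀ (_∙_ : Connective) {P Q R : FClass} →
           (∀ {n} {a : Formula (suc n)} {b} → Q b → (∃' a ∙ b) ⟺ ∃' (a ∙ wk b)) → WkClosed Q →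
           (∀ {n} {a b : Formula n} → P a → Q b → Eqv (ExBlock R) (a ∙ b)) →
           ExBlock P a → Q b → Eqv (ExBlock R) (a ∙ b)
  pull-∃ _∙_ pull w base (ex-base p) q = base p q
  pull-∃ _∙_ pull w base (ex-step p) q = Eqv-⟺ (pull q) (Eqv-∃ (pull-∃ _∙_ pull w base p (w q)))

  pull-∀ : ∀ (_∙_ : Connective) {P Q R : FClass} →
           (∀ {n} {a : Formula (suc n)} {b} → Q b → (∀' a ∙ b) ⟺ ∀' (a ∙ wk b)) → WkClosed Q →
           (∀ {n} {a b : Formula n} → P a → Q b → Eqv (AllBlock R) (a ∙ b)) →
           AllBlock P a → Q b → Eqv (AllBlock R) (a ∙ b)
  pull-∀ _∙_ pull w base (all-base p) q = base p q
  pull-∀ _∙_ pull w base (all-step p) q = Eqv-⟺ (pull q) (Eqv-∀ (pull-∀ _∙_ pull w base p (w q)))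

  Eqv-ex : ∀ {P : FClass} → Eqv P φ → Eqv (ExBlock P) φ
  Eqv-ex (χ , p , e) = χ , ex-base p , e

  Eqv-all : ∀ {P : FClass} → Eqv P φ → Eqv (AllBlock P) φ
  Eqv-all (χ , p , e) = χ , all-base p , e

  mutual
    Sig-∧ : ∀ m → Sig m a → Sig m b → Eqv (Sig m) (a ∧' b)
    Sig-∧ zero p q = _ , qf-∧ p q , ⟺-refl
    Sig-∧ (suc m) =
      pull-∃ _∧'_ {P = Pi m} {Q = Sig (suc m)} (λ _ → ∃∧-pull) (Sig-sub (suc m) _) λ p q →
        Eqv-⟺ ∧-swap (pull-∃ _∧'_ {P = Pi m} {Q = Pi m} (λ _ → ∃∧-pull) (Pi-sub m _)
          (λ p q → Eqv-ex (Pi-∧ m p q)) q p)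

    Pi-∧ : ∀ m → Pi m a → Pi m b → Eqv (Pi m) (a ∧' b)
    Pi-∧ zero p q = _ , qf-∧ p q , ⟺-refl
    Pi-∧ (suc m) =
      pull-∀ _∧'_ {P = Sig m} {Q = Pi (suc m)} (λ _ → ∀∧-pull) (Pi-sub (suc m) _) λ p q →
        Eqv-⟺ ∧-swap (pull-∀ _∧'_ {P = Sig m} {Q = Sig m} (λ _ → ∀∧-pull) (Sig-sub m _)
          (λ p q → Eqv-all (Sig-∧ m p q)) q p)

  mutual
    Sig-∨ : ∀ m → LEM< m → Sig m a → Sig m b → Eqv (Sig m) (a ∨' b)
    Sig-∨ zero L p q = _ , qf-∨ p q , ⟺-refl
    Sig-∨ (suc m) L =
      pull-∃ _∨'_ {P = Pi m} {Q = Sig (suc m)} (λ _ → ∃∨-pull) (Sig-sub (suc m) _) λ p q →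
        Eqv-⟺ ∨-swap (pull-∃ _∨'_ {P = Pi m} {Q = Pi m} (λ _ → ∃∨-pull) (Pi-sub m _)
          (λ p q → Eqv-ex (Pi-∨ m (LEM<-pred L) p q (Pi-dec m L q))) q p)

    -- Two disjoined universal blocks can be merged as soon as one disjunct is decidable.
    Pi-∨ : ∀ m → LEM< m → Pi m a → Pi m b → Dec b → Eqv (Pi m) (a ∨' b)
    Pi-∨ zero L p q _ = _ , qf-∨ p q , ⟺-refl
    Pi-∨ (suc m) L p q dec =
      pull-∀ _∨'_ {P = Sig m} {Q = λ b → Pi (suc m) b × Dec b} (λ q → ∀∨-pull (proj₂ q))
        (λ {_} {φ} q → Pi-sub (suc m) _ (proj₁ q) , Dec-wk φ (proj₂ q))
        (λ p q → Eqv-⟺ ∨-swap (pull-∀ _∨'_ {P = Sig m} {Q = Sig m} (λ q → ∀∨-pull (L (n<1+n m) _ q)) (Sig-sub m _)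
          (λ p q → Eqv-all (Sig-∨ m (LEM<-pred L) p q)) (proj₁ q) p))
        p (q , dec)

  ⇒-dual-∨ : Der A [] (a ∨' dual a) → (a ⇒ b) ⟺ dual a ∨' b
  ⇒-dual-∨ {a = a} d =
    ⇒I (∨E (closed d) (∨I₂ (⇒E v1 v0)) (∨I₁ v0)) ,
    ⇒I (⇒I (∨E v1 (⊥E (⇒E (⇒E (dual⇒¬ a) v0) v1)) v0))

  mutual
    -- Level `suc j` of excluded middle is spent on implications, where the prenex form of the
    -- premise is replaced by its dual, and in `prenex-Pi` also on merging two Π-disjuncts. A
    -- quantifier of the wrong kind costs one degree by `bounded-alt`, so the recursion passes to
    -- the level below.
    prenex-Sig : ∀ (φ : Formula n) j → LEM< (suc (suc j)) → Bounded plus j φ → Eqv (Sig (suc j)) φ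
    prenex-Sig (t ≐ u) j L h = _ , QF⇒Sig (suc j) qf-eq , ⟺-refl
    prenex-Sig ⊥' j L h = _ , QF⇒Sig (suc j) qf-⊥ , ⟺-refl
    prenex-Sig (a ∧' b) j L h
      with _ , p , e ← prenex-Sig a j L (Allₚ.++⁻ˡ (Alt a) h) | _ , q , f ← prenex-Sig b j L (Allₚ.++⁻ʳ (Alt a) h)
      = Eqv-⟺ (∧-cong e f) (Sig-∧ (suc j) p q)
    prenex-Sig (a ∨' b) j L h
      with _ , p , e ← prenex-Sig a j L (Allₚ.++⁻ˡ (Alt a) h) | _ , q , f ← prenex-Sig b j L (Allₚ.++⁻ʳ (Alt a) h)
      = Eqv-⟺ (∨-cong e f) (Sig-∨ (suc j) (LEM<-pred L) p q)
    prenex-Sig (a ⇒ b) j L h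
      with h₁ , h₂ ← bounded-⇒ plus {a = a} {b} h
      with _ , p , e ← prenex-Pi a j L h₁ | _ , q , f ← prenex-Sig b j L h₂
      = Eqv-⟺ (⟺-trans (⇒-cong e f) (⇒-dual-∨ (Pi-∨-dual (suc j) L p)))
          (Sig-∨ (suc j) (LEM<-pred L) (Pi-dual (suc j) p) q)
    prenex-Sig (∀' a) zero L h = ⊥-elim (degree-quant-zero minus a (bounded-alt minus a h))
    prenex-Sig (∀' a) (suc j) L h =
      Eqv-ex (Eqv-∀ (prenex-Pi a j (LEM<-pred L) (degree-quant minus a (bounded-alt minus a h))))
    prenex-Sig (∃' a) j L h = Eqv-∃ (prenex-Sig a j L (bounded-same plus a h))

    prenex-Pi : ∀ (φ : Formula n) j → LEM< (suc (suc j)) → Bounded minus j φ → Eqv (Pi (suc j)) φ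
    prenex-Pi (t ≐ u) j L h = _ , QF⇒Pi (suc j) qf-eq , ⟺-refl
    prenex-Pi ⊥' j L h = _ , QF⇒Pi (suc j) qf-⊥ , ⟺-refl
    prenex-Pi (a ∧' b) j L h
      with _ , p , e ← prenex-Pi a j L (Allₚ.++⁻ˡ (Alt a) h) | _ , q , f ← prenex-Pi b j L (Allₚ.++⁻ʳ (Alt a) h)
      = Eqv-⟺ (∧-cong e f) (Pi-∧ (suc j) p q)
    prenex-Pi (a ∨' b) j L h
      with _ , p , e ← prenex-Pi a j L (Allₚ.++⁻ˡ (Alt a) h) | _ , q , f ← prenex-Pi b j L (Allₚ.++⁻ʳ (Alt a) h)
      = Eqv-⟺ (∨-cong e f) (Pi-∨ (suc j) (LEM<-pred L) p q (Pi-dec (suc j) L q))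
    prenex-Pi (a ⇒ b) j L h
      with h₁ , h₂ ← bounded-⇒ minus {a = a} {b} h
      with _ , p , e ← prenex-Sig a j L h₁ | _ , q , f ← prenex-Pi b j L h₂
      = Eqv-⟺ (⟺-trans (⇒-cong e f) (⇒-dual-∨ (Sig-∨-dual (suc j) L p)))
          (Pi-∨ (suc j) (LEM<-pred L) (Sig-dual (suc j) p) q (Pi-dec (suc j) L q))
    prenex-Pi (∀' a) j L h = Eqv-∀ (prenex-Pi a j L (bounded-same minus a h))
    prenex-Pi (∃' a) zero L h = ⊥-elim (degree-quant-zero plus a (bounded-alt plus a h))
    prenex-Pi (∃' a) (suc j) L h =
      Eqv-all (Eqv-∃ (prenex-Sig a j (LEM<-pred L) (degree-quant plus a (bounded-alt plus a h))))

  -- The formula as a whole may mix Σ_k and Π_k parts and is not prenexed. Only its outermost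
  -- quantified subformulas are, and decidability is closed under propositional connectives.
  degree-dec : ∀ k → LEM< (suc k) → (φ : Formula n) → Degree≤ k φ → Dec φ
  degree-dec k L (t ≐ u) h = eq-dec t u
  degree-dec k L ⊥' h = QF-dec qf-⊥
  degree-dec k L (a ∧' b) h =
    dec-∧ (degree-dec k L a (Allₚ.++⁻ˡ (Alt a) h)) (degree-dec k L b (Allₚ.++⁻ʳ (Alt a) h))
  degree-dec k L (a ∨' b) h =
    dec-∨ (degree-dec k L a (Allₚ.++⁻ˡ (Alt a) h)) (degree-dec k L b (Allₚ.++⁻ʳ (Alt a) h))
  degree-dec k L (a ⇒ b) h with h₁ , h₂ ← degree-⇒ {a = a} {b} h = dec-⇒ (degree-dec k L a h₁) (degree-dec k L b h₂)
  degree-dec zero L (∀' a) h = ⊥-elim (degree-quant-zero minus a h)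
  degree-dec (suc k) L (∀' a) h
    with _ , p , e ← Eqv-∀ (prenex-Pi a k L (degree-quant minus a h)) = Dec-⟺ e (Pi-dec (suc k) L p)
  degree-dec zero L (∃' a) h = ⊥-elim (degree-quant-zero plus a h)
  degree-dec (suc k) L (∃' a) h
    with _ , p , e ← Eqv-∃ (prenex-Sig a k L (degree-quant plus a h)) = Dec-⟺ e (L (n<1+n (suc k)) _ p)

-- The negative translation

K : ∀ {n} → Formula n → Formula n → Formula n
K C a = (a ⇒ C) ⇒ C

-- ⟦ φ ⟧ C is the type of values of φ in call-by-value continuation-passing style with answer formula C.
⟦_⟧ : ∀ {n} → Formula n → Formula n → Formula n
⟦ t ≐ u ⟧ C = t ≐ u
⟦ ⊥' ⟧ C = ⊥'
⟦ a ∧' b ⟧ C = ⟦ a ⟧ C ∧' ⟦ b ⟧ C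
⟦ a ∨' b ⟧ C = ⟦ a ⟧ C ∨' ⟦ b ⟧ C
⟦ a ⇒ b ⟧ C = ⟦ a ⟧ C ⇒ K C (⟦ b ⟧ C)
⟦ ∀' a ⟧ C = ∀' (K (wk C) (⟦ a ⟧ (wk C)))
⟦ ∃' a ⟧ C = ∃' (⟦ a ⟧ (wk C))

⟦⟧-sub : ∀ {n m} (σ : Subst n m) φ C → sub σ (⟦ φ ⟧ C) ≡ ⟦ sub σ φ ⟧ (sub σ C)
⟦⟧-sub σ (t ≐ u) C = refl
⟦⟧-sub σ ⊥' C = refl
⟦⟧-sub σ (a ∧' b) C = cong₂ _∧'_ (⟦⟧-sub σ a C) (⟦⟧-sub σ b C)
⟦⟧-sub σ (a ∨' b) C = cong₂ _∨'_ (⟦⟧-sub σ a C) (⟦⟧-sub σ b C)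
⟦⟧-sub σ (a ⇒ b) C = cong₂ (λ x y → x ⇒ K (sub σ C) y) (⟦⟧-sub σ a C) (⟦⟧-sub σ b C)
⟦⟧-sub σ (∀' a) C =
  cong ∀' (cong₂ K (lift-wk σ C) (trans (⟦⟧-sub (lift σ) a (wk C)) (cong ⟦ sub (lift σ) a ⟧ (lift-wk σ C))))
⟦⟧-sub σ (∃' a) C = cong ∃' (trans (⟦⟧-sub (lift σ) a (wk C)) (cong ⟦ sub (lift σ) a ⟧ (lift-wk σ C)))

⟦⟧-wk : ∀ {n} (φ C : Formula n) → ⟦ wk φ ⟧ (wk C) ≡ wk (⟦ φ ⟧ C)
⟦⟧-wk φ C = sym (⟦⟧-sub (var ∘ suc) φ C)

⟦⟧-inst : ∀ {n} (a : Formula (suc n)) C t → (⟦ a ⟧ (wk C)) [ t ] ≡ ⟦ a [ t ] ⟧ C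
⟦⟧-inst a C t = trans (⟦⟧-sub _ a (wk C)) (cong ⟦ a [ t ] ⟧ (wk-inst C t))

stepS-wk : ∀ {n} (C : Formula n) → stepS (wk C) ≡ wk C
stepS-wk C = trans (stepS-sub (wk C)) (sub-sub stepσ (var ∘ suc) C)

⟦⟧-stepS : ∀ {n} (a : Formula (suc n)) C → stepS (⟦ a ⟧ (wk C)) ≡ ⟦ stepS a ⟧ (wk C)
⟦⟧-stepS a C = trans (⟦⟧-sub _ a (wk C)) (cong ⟦ stepS a ⟧ (stepS-wk C))

⟦⟧-ctx : ∀ {n} (C : Formula n) Γ → map (λ a → ⟦ a ⟧ (wk C)) (map wk Γ) ≡ map wk (map (λ a → ⟦ a ⟧ C) Γ)
⟦⟧-ctx C = map-commute (λ a → ⟦⟧-wk a C)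

module Translation (A : Theory) (cl : SubClosed A) where

  open Logic A cl

  private variable
    n : ℕ
    Γ : List (Formula n)
    a b C φ : Formula n

  K-ret : Der A Γ a → Der A Γ (K C a)
  K-ret d = ⇒I (⇒E v0 (↑ d))

  K-run : Der A Γ (K C a) → Der A (a ∷ Γ) C → Der A Γ C
  K-run d e = ⇒E d (⇒I e)

  K-bind : Der A Γ (K C a) → Der A (a ∷ Γ) (K C b) → Der A Γ (K C b)
  K-bind d e = ⇒I (K-run (↑ d) (⇒E (⇒E (↑ (↑ (⇒I e))) v0) v1))

  sound : ∀ (X : Formula 0 → Set) →
          (∀ {n} ψ → X ψ → (C : Formula n) → Der A [] (K C (⟦ emb ψ ⟧ C))) →
          ∀ {n} {Γ : List (Formula n)} {φ} → Der (PA+ X) Γ φ → ∀ C → Der A (map (λ a → ⟦ a ⟧ C) Γ) (K C (⟦ φ ⟧ C))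
  sound X ax = go
    where
    T⟦_⟧ : List (Formula n) → Formula n → List (Formula n)
    T⟦ Γ ⟧ C = map (λ a → ⟦ a ⟧ C) Γ

    go : Der (PA+ X) Γ φ → ∀ C → Der A (T⟦ Γ ⟧ C) (K C (⟦ φ ⟧ C))
    go (hyp x) C = K-ret (hyp (∈-map⁺ _ x))
    -- As with a control operator, the right disjunct is returned at once; if it is ever applied to
    -- a value of `ψ`, the saved continuation is called again with that value as left disjunct.
    go (axm (inj₁ (ψ , refl))) C = ⇒I (⇒E v0 (∨I₂ (⇒I (⇒I (⇒E v2 (∨I₁ v1))))))
    go (axm (inj₂ (ψ , x , refl))) C = closed (ax ψ x C)
    go (⊥E d) C = K-bind (go d C) (⊥E v0)
    go (∧I d e) C = K-bind (go d C) (K-bind (↑ (go e C)) (K-ret (∧I v1 v0)))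
    go (∧E₁ d) C = K-bind (go d C) (K-ret (∧E₁ v0))
    go (∧E₂ d) C = K-bind (go d C) (K-ret (∧E₂ v0))
    go (∨I₁ d) C = K-bind (go d C) (K-ret (∨I₁ v0))
    go (∨I₂ d) C = K-bind (go d C) (K-ret (∨I₂ v0))
    go (∨E d e f) C =
      K-bind (go d C) (∨E v0 (⇒E (↑ (↑ (⇒I (go e C)))) v0) (⇒E (↑ (↑ (⇒I (go f C)))) v0))
    go (⇒I d) C = K-ret (⇒I (go d C))
    go (⇒E d e) C = K-bind (go d C) (K-bind (↑ (go e C)) (⇒E v1 v0))
    go {Γ = Γ} (∀I d) C = K-ret (∀I (castΓ (⟦⟧-ctx C Γ) (go d (wk C))))
    go (∀E {a = a} d t) C = K-bind (go d C) (cast (cong₂ K (wk-inst C t) (⟦⟧-inst a C t)) (∀E v0 t))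
    go (∃I {a = a} t d) C = K-bind (go d C) (K-ret (∃I t (cast (sym (⟦⟧-inst a C t)) v0)))
    go {Γ = Γ} (∃E {c = c} d e) C =
      K-bind (go d C) (∃E v0 (⇒E (↑ (↑ (⇒I
        (cast (cong (K (wk C)) (⟦⟧-wk c C)) (castΓ (cong (_ ∷_) (⟦⟧-ctx C Γ)) (go e (wk C))))))) v0))
    go (eq-refl t) C = K-ret (eq-refl t)
    go (eq-subst a {t} {u} d e) C =
      K-bind (go d C) (K-bind (↑ (go e C)) (K-ret
        (cast (⟦⟧-inst a C u) (eq-subst (⟦ a ⟧ (wk C)) v1 (cast (sym (⟦⟧-inst a C t)) v0)))))
    go (S≠0 t) C = K-ret (⇒I (⊥E (⇒E (S≠0 t) v0)))
    go (S-inj t u) C = K-ret (⇒I (K-ret (⇒E (S-inj t u) v0)))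
    go (ax-P i ts) C = K-ret (ax-P i ts)
    go (ax-C f gs ts) C = K-ret (ax-C f gs ts)
    go (ax-R0 f g ts) C = K-ret (ax-R0 f g ts)
    go (ax-RS f g t ts) C = K-ret (ax-RS f g t ts)
    go (ind a d e) C =
      -- Induction on computations rather than values: the translated step only yields a
      -- computation, and a value of the universal formula is a family of computations.
      K-bind (go e C) (K-ret (ind (K (wk C) a')
        (cast (cong₂ K (sym (wk-inst C 𝟎)) (sym (⟦⟧-inst a C 𝟎))) (↑ (go d C)))
        (∀I (⇒I (cast (cong₂ K (sym (stepS-wk C)) (sym (⟦⟧-stepS a C)))
          (K-bind v0 (K-bind (∀E₀ (K (wk C) (a' ⇒ K (wk C) (⟦ stepS a ⟧ (wk C)))) v2) (⇒E v0 v1))))))))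
      where
      a' : Formula _
      a' = ⟦ a ⟧ (wk C)

  -- Comparison of formulas with their translations

  module Decidable (k : ℕ) (dec : ∀ {n} (φ : Formula n) → Degree≤ k φ → Dec φ) where

    mutual
      degree-⟦⟧ : ∀ (φ : Formula n) → Degree≤ k φ → ∀ C {Γ} → Der A Γ φ → Der A Γ (⟦ φ ⟧ C)
      degree-⟦⟧ (t ≐ u) h C d = d
      degree-⟦⟧ ⊥' h C d = d
      degree-⟦⟧ (a ∧' b) h C d =
        ∧I (degree-⟦⟧ a (Allₚ.++⁻ˡ (Alt a) h) C (∧E₁ d)) (degree-⟦⟧ b (Allₚ.++⁻ʳ (Alt a) h) C (∧E₂ d))
      degree-⟦⟧ (a ∨' b) h C d =
        ∨E d (∨I₁ (degree-⟦⟧ a (Allₚ.++⁻ˡ (Alt a) h) C v0)) (∨I₂ (degree-⟦⟧ b (Allₚ.++⁻ʳ (Alt a) h) C v0))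
      degree-⟦⟧ (a ⇒ b) h C d with h₁ , h₂ ← degree-⇒ {a = a} {b} h =
        -- If the value of the premise only yields C, the required computation ignores its
        -- continuation and answers C.
        ⇒I (∨E (⟦⟧-degree a h₁ C v0) (K-ret (degree-⟦⟧ b h₂ C (⇒E (↑ (↑ d)) v0))) (⇒I v1))
      degree-⟦⟧ (∀' a) h C d =
        cut d (∀I (K-ret (degree-⟦⟧ a (degree-body minus a h) (wk C) (∀E₀ a v0))))
      degree-⟦⟧ (∃' a) h C d = ∃E d (∃I₀ (⟦ a ⟧ (wk C)) (degree-⟦⟧ a (degree-body plus a h) (wk C) v0))

      -- The disjunct C accounts for computations that answer without returning a value; wherever φ
      -- would fail, decidability exhibits such a computation.
      ⟦⟧-degree : ∀ (φ : Formula n) → Degree≤ k φ → ∀ C {Γ} → Der A Γ (⟦ φ ⟧ C) → Der A Γ (φ ∨' C)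
      ⟦⟧-degree (t ≐ u) h C d = ∨I₁ d
      ⟦⟧-degree ⊥' h C d = ∨I₁ d
      ⟦⟧-degree (a ∧' b) h C d =
        ∨E (⟦⟧-degree a (Allₚ.++⁻ˡ (Alt a) h) C (∧E₁ d))
          (∨E (⟦⟧-degree b (Allₚ.++⁻ʳ (Alt a) h) C (∧E₂ (↑ d))) (∨I₁ (∧I v1 v0)) (∨I₂ v0))
          (∨I₂ v0)
      ⟦⟧-degree (a ∨' b) h C d =
        ∨E d (∨E (⟦⟧-degree a (Allₚ.++⁻ˡ (Alt a) h) C v0) (∨I₁ (∨I₁ v0)) (∨I₂ v0))
             (∨E (⟦⟧-degree b (Allₚ.++⁻ʳ (Alt a) h) C v0) (∨I₁ (∨I₂ v0)) (∨I₂ v0))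
      ⟦⟧-degree (a ⇒ b) h C d with h₁ , h₂ ← degree-⇒ {a = a} {b} h =
        ∨E (closed (dec a h₁))
          (∨E (closed (dec b h₂)) (∨I₁ (⇒I v1))
            -- Here `a` holds and `b` fails, so running the implication on `a` cannot deliver `b`
            -- and must end in C.
            (∨I₂ (K-run (⇒E (↑ (↑ d)) (degree-⟦⟧ a h₁ C v1))
              (∨E (⟦⟧-degree b h₂ C v0) (⊥E (⇒E v2 v0)) v0))))
          (∨I₁ (⇒I (⊥E (⇒E v1 v0))))
      -- Deciding ∃x¬a replaces the constant-domain step from ∀x(a ∨ C) to ∀xa ∨ C.
      ⟦⟧-degree (∀' a) h C d = cut d
        (∨E (closed (dec (∃' (~ a)) (degree-∃~ a h)))
          (∨I₂ (∃E v0 (K-run (∀E₀ (K (wk C) (⟦ a ⟧ (wk C))) v2)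
            (∨E (⟦⟧-degree a h' (wk C) v0) (⊥E (⇒E v2 v0)) v0))))
          (∨I₁ (∀I (∨E (closed (dec a h')) v0 (⊥E (⇒E v1 (∃I₀ (~ a) v0)))))))
        where
        h' : Degree≤ k a
        h' = degree-body minus a h
      ⟦⟧-degree (∃' a) h C d =
        ∃E d (∨E (⟦⟧-degree a (degree-body plus a h) (wk C) v0) (∨I₁ (∃I₀ a v0)) (∨I₂ v0))

    mutual
      R-⟦⟧ : ∀ {φ : Formula n} → R⁺ k φ → ∀ C {Γ} → Der A Γ (~ φ ⇒ C) → Der A Γ (K C (⟦ φ ⟧ C))
      R-⟦⟧ (R-base {φ = φ} f) C d with h ← F⁺⇒Degree≤ φ f =
        ∨E (closed (dec φ h)) (K-ret (degree-⟦⟧ φ h C v0)) (⇒I (⇒E (↑ (↑ d)) v1))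
      R-⟦⟧ (R-∧ p q) C d =
        K-bind (R-⟦⟧ p C (⇒I (⇒E (↑ d) (⇒I (⇒E v1 (∧E₁ v0))))))
          (K-bind (R-⟦⟧ q C (⇒I (⇒E (↑ (↑ d)) (⇒I (⇒E v1 (∧E₂ v0)))))) (K-ret (∧I v1 v0)))
      R-⟦⟧ (R-∨ p q) C d =
        -- The second disjunct is tried inside the refutation of the first, so that both refutations
        -- are available to refute the disjunction.
        ⇒I (K-run (R-⟦⟧ p C (⇒I (K-run (R-⟦⟧ q C (⇒I (⇒E (↑ (↑ (↑ d))) (⇒I (∨E v0 (⇒E v3 v0) (⇒E v2 v0))))))
              (⇒E v2 (∨I₂ v0))))) (⇒E v1 (∨I₁ v0)))
      R-⟦⟧ (R-∀ {a = a} p) C d =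
        cut d (K-ret (∀I (R-⟦⟧ p (wk C) (⇒I (⇒E v1 (⇒I (⇒E v1 (∀E₀ a v0))))))))
      R-⟦⟧ (R-⇒ p q) C d =
        K-ret (⇒I (K-bind (J-⟦⟧ p C v0) (R-⟦⟧ q C (⇒I (⇒E (↑ (↑ (↑ d))) (⇒I (⇒E v1 (⇒E v0 v2))))))))

      J-⟦⟧ : ∀ {φ : Formula n} → J⁺ k φ → ∀ C {Γ} → Der A Γ (⟦ φ ⟧ C) → Der A Γ (K C φ)
      J-⟦⟧ (J-base {φ = φ} f) C d = ∨E (⟦⟧-degree φ (F⁺⇒Degree≤ φ f) C d) (K-ret v0) (⇒I v1)
      J-⟦⟧ (J-∧ p q) C d = K-bind (J-⟦⟧ p C (∧E₁ d)) (K-bind (J-⟦⟧ q C (∧E₂ (↑ d))) (K-ret (∧I v1 v0)))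
      J-⟦⟧ (J-∨ p q) C d =
        ∨E d (K-bind (J-⟦⟧ p C v0) (K-ret (∨I₁ v0))) (K-bind (J-⟦⟧ q C v0) (K-ret (∨I₂ v0)))
      J-⟦⟧ (J-∃ {a = a} p) C d = ∃E d (K-bind (J-⟦⟧ p (wk C) v0) (K-ret (∃I₀ a v0)))
      J-⟦⟧ (J-⇒ p q) C d =
        -- A refutation of the premise proves the implication vacuously and so reaches C through the
        -- continuation, which is what `R-⟦⟧` asks for.
        ⇒I (K-run (K-bind (R-⟦⟧ p C (⇒I (⇒E v1 (⇒I (⊥E (⇒E v1 v0))))))
              (K-bind (⇒E (↑ (↑ d)) v0) (J-⟦⟧ q C v0)))
            (⇒E v1 (⇒I v1)))

    -- An axiom only has to be carried into the translation, so ∀ and ∃ may alternate freely.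
    -- Premises of implications travel in the opposite direction and are handled by `J-⟦⟧`.
    Q-⟦⟧ : ∀ {φ : Formula n} → Q⁺ k φ → ∀ C {Γ} → Der A Γ φ → Der A Γ (K C (⟦ φ ⟧ C))
    Q-⟦⟧ Q-eq C d = K-ret d
    Q-⟦⟧ Q-⊥ C d = K-ret d
    Q-⟦⟧ (Q-∧ p q) C d = K-bind (Q-⟦⟧ p C (∧E₁ d)) (K-bind (Q-⟦⟧ q C (∧E₂ (↑ d))) (K-ret (∧I v1 v0)))
    Q-⟦⟧ (Q-∨ p q) C d =
      ∨E d (K-bind (Q-⟦⟧ p C v0) (K-ret (∨I₁ v0))) (K-bind (Q-⟦⟧ q C v0) (K-ret (∨I₂ v0)))
    Q-⟦⟧ (Q-∀ {a = a} p) C d = cut d (K-ret (∀I (Q-⟦⟧ p (wk C) (∀E₀ a v0))))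
    Q-⟦⟧ (Q-∃ {a = a} p) C d = ∃E d (K-bind (Q-⟦⟧ p (wk C) v0) (K-ret (∃I₀ (⟦ a ⟧ (wk C)) v0)))
    Q-⟦⟧ (Q-⇒ p q) C d = K-ret (⇒I (K-bind (J-⟦⟧ p C v0) (Q-⟦⟧ q C (⇒E (↑ (↑ d)) v0))))

-- Cantor pairing

infixl 8 _⊕_

addF : PR 2
addF = Rf (Pf 0F) (Cf Sf (Pf 0F ∷ []))

triF : PR 1
triF = Rf Zf (Cf Sf (Cf addF (Pf 1F ∷ Pf 0F ∷ []) ∷ []))

_⊕_ : ∀ {n} → Term n → Term n → Term n
t ⊕ u = app addF (t ∷ u ∷ [])

tri : ∀ {n} → Term n → Term n
tri t = app triF (t ∷ [])

-- Position on the walk along the antidiagonals: the successor of (t, u + 1) is (t + 1, u), and that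
-- of (t, 0) is (0, t + 1). The laws `code-00`, `code-0S` and `code-S` of this walk yield totality
-- and injectivity, which take the place of projection functions.
code : ∀ {n} → Term n → Term n → Term n
code t u = t ⊕ tri (t ⊕ u)

module Pairing (A : Theory) (cl : SubClosed A) where

  open Logic A cl

  private variable
    n m : ℕ
    Γ : List (Formula n)
    t u t' u' : Term n

  ⊕-cong : Der A Γ (t ≐ t') → Der A Γ (u ≐ u') → Der A Γ (t ⊕ u ≐ t' ⊕ u')
  ⊕-cong {t = t} {t'} {u} {u'} d e =
    eq-trans
      (cast (cong₂ (λ x y → t ⊕ x ≐ t' ⊕ y) (subT-inst-renT t u) (subT-inst-renT t' u)) (eq-cong (var 0F ⊕ renT suc u) d))
      (cast (cong₂ (λ x y → x ⊕ u ≐ y ⊕ u') (subT-inst-renT u t') (subT-inst-renT u' t')) (eq-cong (renT suc t' ⊕ var 0F) e))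

  tri-cong : Der A Γ (t ≐ t') → Der A Γ (tri t ≐ tri t')
  tri-cong = eq-cong (tri (var 0F))

  code-cong : Der A Γ (t ≐ t') → Der A Γ (u ≐ u') → Der A Γ (code t u ≐ code t' u')
  code-cong d e = ⊕-cong d (tri-cong (⊕-cong d e))

  0⊕ : ∀ (u : Term n) → Der A Γ (𝟎 ⊕ u ≐ u)
  0⊕ u = eq-trans (ax-R0 _ _ _) (ax-P 0F _)

  S⊕ : ∀ (t u : Term n) → Der A Γ (𝐒 t ⊕ u ≐ 𝐒 (t ⊕ u))
  S⊕ t u = eq-trans (ax-RS _ _ _ _) (eq-trans (ax-C _ _ _) (eq-S (ax-P 0F _)))

  tri-0 : Der A {n} Γ (tri 𝟎 ≐ 𝟎)
  tri-0 = ax-R0 _ _ _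

  tri-S : ∀ (t : Term n) → Der A Γ (tri (𝐒 t) ≐ 𝐒 (t ⊕ tri t))
  tri-S t = eq-trans (ax-RS _ _ _ _) (eq-trans (ax-C _ _ _)
    (eq-S (eq-trans (ax-C _ _ _) (⊕-cong (ax-P 1F _) (ax-P 0F _)))))

  ⊕0 : ∀ (t : Term n) → Der A Γ (t ⊕ 𝟎 ≐ t)
  ⊕0 t = ∀E (ind (var 0F ⊕ 𝟎 ≐ var 0F) (0⊕ 𝟎) (∀I (⇒I (eq-trans (S⊕ _ _) (eq-S v0))))) t

  pair : Term n → Term n → Subst 2 n
  pair t u 0F = t
  pair t u 1F = u

  ⊕S : ∀ (t u : Term n) → Der A Γ (t ⊕ 𝐒 u ≐ 𝐒 (t ⊕ u))
  ⊕S t u = closed (Der-sub cl (pair t u)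
    (∀E (ind (var 0F ⊕ 𝐒 (var 2F) ≐ 𝐒 (var 0F ⊕ var 2F))
      (eq-trans (0⊕ _) (eq-S (eq-sym (0⊕ _))))
      (∀I (⇒I (eq-trans (S⊕ _ _) (eq-S (eq-trans v0 (eq-sym (S⊕ _ _)))))))) (var 0F)))

  code-00 : Der A {n} Γ (code 𝟎 𝟎 ≐ 𝟎)
  code-00 = eq-trans (0⊕ _) (eq-trans (tri-cong (0⊕ _)) tri-0)

  code-0S : ∀ (t : Term n) → Der A Γ (code 𝟎 (𝐒 t) ≐ 𝐒 (code t 𝟎))
  code-0S t = eq-trans (0⊕ _) (eq-trans (tri-cong (0⊕ _)) (eq-trans (tri-S t)
    (eq-S (⊕-cong (eq-refl t) (tri-cong (eq-sym (⊕0 t)))))))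

  code-S : ∀ (t u : Term n) → Der A Γ (code (𝐒 t) u ≐ 𝐒 (code t (𝐒 u)))
  code-S t u = eq-trans (S⊕ _ _)
    (eq-S (⊕-cong (eq-refl t) (tri-cong (eq-trans (S⊕ t u) (eq-sym (⊕S t u))))))

  zero-or-suc : ∀ (i : Fin n) → Der A Γ (var i ≐ 𝟎 ∨' ∃' (var (suc i) ≐ 𝐒 (var 0F)))
  zero-or-suc i = ∀E (ind (var 0F ≐ 𝟎 ∨' ∃' (var 1F ≐ 𝐒 (var 0F))) (∨I₁ (eq-refl _))
    (∀I (⇒I (∨I₂ (∃I (var 0F) (eq-refl _)))))) (var i)

  code-total : Der A {n} Γ (∀' (∃' (∃' (var 2F ≐ code (var 1F) (var 0F)))))
  code-total = ind (∃' (∃' (var 2F ≐ code (var 1F) (var 0F))))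
    (∃I 𝟎 (∃I 𝟎 (eq-sym code-00)))
    (∀I (⇒I (∃E v0 (∃E v0 (∨E (zero-or-suc 0F)
      (∃I 𝟎 (∃I (𝐒 (var 1F)) (eq-trans (eq-S (eq-trans v1 (code-cong (eq-refl _) v0))) (eq-sym (code-0S _)))))
      (∃E v0 (∃I (𝐒 (var 2F)) (∃I (var 0F)
        (eq-trans (eq-S (eq-trans v2 (code-cong (eq-refl _) v0))) (eq-sym (code-S _ _)))))))))))

  code-zero⁻¹ : ∀ (a b : Fin n) → Der A Γ (𝟎 ≐ code (var a) (var b)) → Der A Γ (var a ≐ 𝟎 ∧' var b ≐ 𝟎)
  code-zero⁻¹ a b d = cut d (∨E (zero-or-suc a)
    (∨E (zero-or-suc b) (∧I v1 v0)
      (∃E v0 (⊥E (⇒E (S≠0 _) (eq-sym (eq-trans v3 (eq-trans (code-cong v2 v0) (code-0S _))))))))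
    (∃E v0 (⊥E (⇒E (S≠0 _) (eq-sym (eq-trans v2 (eq-trans (code-cong v0 (eq-refl _)) (code-S _ _))))))))

  code-suc⁻¹ : ∀ (c a b : Fin n) → Der A Γ (𝐒 (var c) ≐ code (var a) (var b)) →
               Der A Γ (var a ≐ 𝟎 ∧' ∃' (var (suc b) ≐ 𝐒 (var 0F) ∧' var (suc c) ≐ code (var 0F) 𝟎)
                        ∨' ∃' (var (suc a) ≐ 𝐒 (var 0F) ∧' var (suc c) ≐ code (var 0F) (𝐒 (var (suc b)))))
  code-suc⁻¹ c a b d = cut d (∨E (zero-or-suc a)
    (∨E (zero-or-suc b)
      (⊥E (⇒E (S≠0 _) (eq-trans v2 (eq-trans (code-cong v1 v0) code-00))))
      (∃E v0 (∨I₁ (∧I v2 (∃I (var 0F) (∧I v0 (⇒E (S-inj _ _) (eq-trans v3 (eq-trans (code-cong v2 v0) (code-0S _))))))))))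
    (∃E v0 (∨I₂ (∃I (var 0F) (∧I v0 (⇒E (S-inj _ _) (eq-trans v2 (eq-trans (code-cong v0 (eq-refl _)) (code-S _ _)))))))))

  Inj : Formula (suc n)
  Inj = ∀' (∀' (∀' (∀' (var 4F ≐ code (var 3F) (var 2F) ⇒ var 4F ≐ code (var 1F) (var 0F) ⇒
                        var 3F ≐ var 1F ∧' var 2F ≐ var 0F))))

  -- Induction on the common code. `code-suc⁻¹` moves both pairs one step back on the walk, where
  -- the hypothesis, general in the pairs, identifies them; pairs reached by different kinds of step
  -- would equate 0 with a successor.
  code-inj-∀ : Der A {n} Γ (∀' Inj)
  code-inj-∀ = ind Inj
    (∀I (∀I (∀I (∀I (⇒I (⇒I (both-0 (code-zero⁻¹ 3F 2F v1) (code-zero⁻¹ 1F 0F v0))))))))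
    (∀I (⇒I (∀I (∀I (∀I (∀I (⇒I (⇒I
      (∨E (code-suc⁻¹ 4F 3F 2F v1)
        (∨E (code-suc⁻¹ 4F 1F 0F v1)
          (∃E (∧E₂ v1) (∃E (∧E₂ v1)
            (∧I (eq-trans (∧E₁ v3) (eq-sym (∧E₁ v2)))
                (eq-trans (∧E₁ v1) (eq-trans (eq-S (∧E₁ (⇒E (⇒E (∀E (∀E (∀E (∀E v6 (var 1F)) 𝟎) (var 0F)) 𝟎) (∧E₂ v1)) (∧E₂ v0)))) (eq-sym (∧E₁ v0)))))))
          (∃E (∧E₂ v1) (∃E v1
            (⊥E (⇒E (S≠0 _) (eq-sym (∧E₂ (⇒E (⇒E (∀E (∀E (∀E (∀E v6 (var 1F)) 𝟎) (var 0F)) (𝐒 (var 2F))) (∧E₂ v1)) (∧E₂ v0)))))))))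
        (∨E (code-suc⁻¹ 4F 1F 0F v1)
          (∃E v1 (∃E (∧E₂ v1)
            (⊥E (⇒E (S≠0 _) (∧E₂ (⇒E (⇒E (∀E (∀E (∀E (∀E v6 (var 1F)) (𝐒 (var 4F))) (var 0F)) 𝟎) (∧E₂ v1)) (∧E₂ v0)))))))
          (∃E v1 (∃E v1
            (cut (⇒E (⇒E (∀E (∀E (∀E (∀E v6 (var 1F)) (𝐒 (var 4F))) (var 0F)) (𝐒 (var 2F))) (∧E₂ v1)) (∧E₂ v0))
              (∧I (eq-trans (∧E₁ v2) (eq-trans (eq-S (∧E₁ v0)) (eq-sym (∧E₁ v1))))
                  (⇒E (S-inj _ _) (∧E₂ v0))))))))))))))))
    where
    v6 : ∀ {a b c d e f g : Formula m} {Γ} → Der A (a ∷ b ∷ c ∷ d ∷ e ∷ f ∷ g ∷ Γ) g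
    v6 = hyp (there (there (there (there (there (there (here refl)))))))

    both-0 : ∀ {a b a' b' : Term m} {Γ} → Der A Γ (a ≐ 𝟎 ∧' b ≐ 𝟎) → Der A Γ (a' ≐ 𝟎 ∧' b' ≐ 𝟎) →
             Der A Γ (a ≐ a' ∧' b ≐ b')
    both-0 d e = ∧I (eq-trans (∧E₁ d) (eq-sym (∧E₁ e))) (eq-trans (∧E₂ d) (eq-sym (∧E₂ e)))

  code-inj : ∀ (a b a' b' : Fin n) → Der A Γ (code (var a) (var b) ≐ code (var a') (var b')) →
             Der A Γ (var a ≐ var a' ∧' var b ≐ var b')
  code-inj a b a' b' d =
    ⇒E (⇒E (∀E (∀E (∀E (∀E (∀E code-inj-∀ (code (var a) (var b))) (var a)) (var b)) (var a')) (var b')) (eq-refl _)) d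

  -- `eq-subst` rewrites one position at a time, so the passage from σ to τ goes through `mid`,
  -- which has changed only variable 0.
  eq-sub₂ : ∀ (φ : Formula (suc (suc n))) (σ τ : Subst (suc (suc n)) m) {Γ} →
            (∀ i → σ (suc (suc i)) ≡ τ (suc (suc i))) →
            Der A Γ (σ 0F ≐ τ 0F) → Der A Γ (σ 1F ≐ τ 1F) → Der A Γ (sub σ φ) → Der A Γ (sub τ φ)
  eq-sub₂ {n} {m} φ σ τ e d₀ d₁ d =
    cast (at β (τ 1F) τ λ { 0F → subT-inst-renT _ _ ; 1F → refl ; (suc (suc i)) → trans (subT-inst-renT _ _) (e i) })
      (eq-subst (sub β φ) d₁ (cast (sym (at β (σ 1F) mid
          λ { 0F → subT-inst-renT _ _ ; 1F → refl ; (suc (suc i)) → subT-inst-renT _ _ }))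
        (cast (at α (τ 0F) mid λ { 0F → refl ; (suc i) → subT-inst-renT _ _ })
          (eq-subst (sub α φ) d₀ (cast (sym (at α (σ 0F) σ λ { 0F → refl ; (suc i) → subT-inst-renT _ _ })) d)))))
    where
    α β : Subst (suc (suc n)) (suc m)
    α 0F = var 0F
    α (suc i) = renT suc (σ (suc i))
    β 0F = renT suc (τ 0F)
    β 1F = var 0F
    β (suc (suc i)) = renT suc (σ (suc (suc i)))
    mid : Subst (suc (suc n)) m
    mid 0F = τ 0F
    mid (suc i) = σ (suc i)
    at : ∀ (α : Subst (suc (suc n)) (suc m)) t (ρ : Subst (suc (suc n)) m) →
         (∀ i → subT (inst t) (α i) ≡ ρ i) → sub α φ [ t ] ≡ sub ρ φ
    at α t ρ h = trans ([]-inst (sub α φ) t) (trans (sub-sub (inst t) α φ) (sub-ext h φ))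

-- Complementing a Σ-formula by a one-variable family

module Separation (A : Theory) (cl : SubClosed A) where

  open Logic A cl
  open Prenex A cl
  open Pairing A cl

  private variable
    n : ℕ

  -- The z-indexed Σ-formula ψ enumerates the instances of the Π-formula dual to φ with a single variable z,
  -- so that one application of the constant-domain rule to wk φ ∨' ψ decides φ.
  separate : ∀ j → LEM< (suc j) → (φ : Formula n) → Sig (suc j) φ →
             Σ (Formula (suc n)) λ ψ → Sig (suc j) ψ × Der A [] (wk φ ∨' ψ) × Der A [] (∀' ψ ⇒ ~ φ)
  separate j L φ (ex-base p) =
    -- With no ∃-block left, φ is Π_j and its dual is Σ_j, so a family constant in z will do.
    wk (dual φ) , Sig-suc j (Sig-sub j _ (Pi-dual j p)) , ⇑ (Pi-∨-dual j L p) ,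
    ⇒I (⇒E (dual⇒¬ φ) (cast (wk-inst (dual φ) 𝟎) (∀E v0 𝟎)))
  separate {n} j L (∃' φ) (ex-step p)
    with ψ , q , d , e ← separate j L φ p
    = proj₁ rep , proj₁ (proj₂ rep) ,
      ⇒E (∨-mono (⇒I v0) (proj₁ (proj₂ (proj₂ rep)))) total ,
      ⇒I (⇒E (↑ refute) (⇒E (↑ (∀-mono (proj₂ (proj₂ (proj₂ rep))))) v0))
    where
    ρ : Subst (suc (suc n)) (suc (suc (suc n)))
    ρ 0F = var 0F
    ρ 1F = var 1F
    ρ (suc (suc i)) = var (suc (suc (suc i)))

    θ : Subst (suc (suc n)) (suc (suc (suc (suc n))))
    θ 0F = var 0F
    θ 1F = var 1F
    θ (suc (suc i)) = var (suc (suc (suc (suc i))))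

    -- `var 2F` is the new index z, read as the code of a value `var 1F` for the outermost
    -- quantifier and an old index `var 0F`. Decoding with ∃ keeps the family in Σ_{j+1}; `ρ` makes
    -- room for z.
    body : Formula (suc (suc (suc n)))
    body = var 2F ≐ code (var 1F) (var 0F) ∧' sub ρ ψ

    wk³ : ∀ χ → sub ρ (wk (wk χ)) ≡ wk (wk (wk χ))
    wk³ χ = trans (sub-sub ρ (var ∘ suc) (wk χ)) (trans (sub-sub _ (var ∘ suc) χ)
      (sym (trans (sub-sub (var ∘ suc) (var ∘ suc) (wk χ)) (sub-sub _ (var ∘ suc) χ))))

    at-code : sub (lift (var ∘ suc)) (sub (lift (var ∘ suc)) (∃' (∃' body))) [ code (var 1F) (var 0F) ]
              ≡ ∃' (∃' (code (var 3F) (var 2F) ≐ code (var 1F) (var 0F) ∧' sub θ ψ))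
    at-code = cong (λ χ → ∃' (∃' (code (var 3F) (var 2F) ≐ code (var 1F) (var 0F) ∧' χ)))
      (trans (sub-sub _ _ (sub _ (sub ρ ψ))) (trans (sub-sub _ _ (sub ρ ψ)) (trans (sub-sub _ ρ ψ)
        (sub-ext (λ { 0F → refl ; 1F → refl ; (suc (suc i)) → refl }) ψ))))

    rep : Eqv (Sig (suc j)) (∃' (∃' body))
    rep = Eqv-∃ (Eqv-∃ (Sig-∧ (suc j) (QF⇒Sig (suc j) qf-eq) (Sig-sub (suc j) ρ q)))

    total : Der A [] (wk (∃' φ) ∨' ∃' (∃' body))
    total = ∃E (∀E code-total (var 0F)) (∃E v0 (∨E (closed (Der-sub cl ρ d))
      (∨I₁ (cast (wk³ (∃' φ))
        (⇒E (closed (Der-sub cl ρ (Der-sub cl (var ∘ suc) (⇒I (∃I₀ φ v0))))) v0)))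
      (∨I₂ (⇒E (closed (⇑ (⇒I (∃I₀ (∃' body) v0)))) (∃I₀ body (∧I v1 v0))))))

    refute : Der A [] (∀' (∃' (∃' body)) ⇒ ~ ∃' φ)
    -- For a witness x of φ and any old index y, the instance z = code x y supplies a pair with the
    -- same code satisfying ψ (placed there by `θ`). Injectivity transports ψ back to x and y; as y
    -- was arbitrary, `e` refutes φ at x.
    refute = ⇒I (⇒I (∃E v0 (⇒E (⇒E (closed e) (∀I
      (∃E (cast at-code (∀E v2 (code (var 1F) (var 0F)))) (∃E v0
        (cast (sym (sub-sub (var ∘ suc) (var ∘ suc) ψ))
          (cut (code-inj 3F 2F 1F 0F (∧E₁ v0))
          (eq-sub₂ ψ θ (λ i → var (suc (suc i))) (λ i → refl)
            (eq-sym (∧E₂ v0)) (eq-sym (∧E₁ v0)) (∧E₂ v1)))))))) v0)))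

-- Closure of the formula classes under substitution

Alt-sub : ∀ {n m} (σ : Subst n m) φ → Alt (sub σ φ) ≡ Alt φ
Alt-sub σ (t ≐ u) = refl
Alt-sub σ ⊥' = refl
Alt-sub σ (a ∧' b) = cong₂ _++_ (Alt-sub σ a) (Alt-sub σ b)
Alt-sub σ (a ∨' b) = cong₂ _++_ (Alt-sub σ a) (Alt-sub σ b)
Alt-sub σ (a ⇒ b) = cong₂ (λ x y → map flipP x ++ y) (Alt-sub σ a) (Alt-sub σ b)
Alt-sub σ (∀' a) = cong (map (pre minus)) (Alt-sub (lift σ) a)
Alt-sub σ (∃' a) = cong (map (pre plus)) (Alt-sub (lift σ) a)

F⁺-sub : ∀ {n m k} (σ : Subst n m) φ → F⁺ k φ → F⁺ k (sub σ φ)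
F⁺-sub {k = k} σ φ h =
  Degree≤⇒F⁺ (sub σ φ) (subst (All (λ p → length p ≤ k)) (sym (Alt-sub σ φ)) (F⁺⇒Degree≤ φ h))

mutual
  R-sub : ∀ {n m k} (σ : Subst n m) {φ} → R⁺ k φ → R⁺ k (sub σ φ)
  R-sub σ (R-base {φ = φ} f) = R-base (F⁺-sub σ φ f)
  R-sub σ (R-∧ p q) = R-∧ (R-sub σ p) (R-sub σ q)
  R-sub σ (R-∨ p q) = R-∨ (R-sub σ p) (R-sub σ q)
  R-sub σ (R-∀ p) = R-∀ (R-sub (lift σ) p)
  R-sub σ (R-⇒ p q) = R-⇒ (J-sub σ p) (R-sub σ q)

  J-sub : ∀ {n m k} (σ : Subst n m) {φ} → J⁺ k φ → J⁺ k (sub σ φ)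
  J-sub σ (J-base {φ = φ} f) = J-base (F⁺-sub σ φ f)
  J-sub σ (J-∧ p q) = J-∧ (J-sub σ p) (J-sub σ q)
  J-sub σ (J-∨ p q) = J-∨ (J-sub σ p) (J-sub σ q)
  J-sub σ (J-∃ p) = J-∃ (J-sub (lift σ) p)
  J-sub σ (J-⇒ p q) = J-⇒ (R-sub σ p) (J-sub σ q)

Q-sub : ∀ {n m k} (σ : Subst n m) {φ} → Q⁺ k φ → Q⁺ k (sub σ φ)
Q-sub σ Q-eq = Q-eq
Q-sub σ Q-⊥ = Q-⊥
Q-sub σ (Q-∧ p q) = Q-∧ (Q-sub σ p) (Q-sub σ q)
Q-sub σ (Q-∨ p q) = Q-∨ (Q-sub σ p) (Q-sub σ q)
Q-sub σ (Q-∀ p) = Q-∀ (Q-sub (lift σ) p)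
Q-sub σ (Q-∃ p) = Q-∃ (Q-sub (lift σ) p)
Q-sub σ (Q-⇒ p q) = Q-⇒ (J-sub σ p) (Q-sub σ q)

-- F_k and E_{k+1} prescribe the degree exactly, so an instance of LEM(Σ_k), whose degree may be smaller, is
-- conjoined with a provable formula altF of the right degree.

altF : Sign → ∀ {n} → ℕ → Formula n
altF s zero = 𝟎 ≐ 𝟎
altF s (suc j) = quant s (altF (flipS s) j)

altPath : Sign → ℕ → Path
altPath s zero = []
altPath s (suc j) = s ∷ altPath (flipS s) j

length-altPath : ∀ s j → length (altPath s j) ≡ j
length-altPath s zero = refl
length-altPath s (suc j) = cong suc (length-altPath (flipS s) j)

Alt-altF : ∀ s {n} j → Alt (altF s {n} j) ≡ altPath s j ∷ []
Alt-altF s zero = refl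
Alt-altF s (suc j) =
  trans (Alt-quant s (altF (flipS s) j)) (trans (cong (map (pre s)) (Alt-altF (flipS s) j)) (cong (_∷ []) (pre-altPath s j)))
  where
  pre-altPath : ∀ s j → pre s (altPath (flipS s) j) ≡ s ∷ altPath (flipS s) j
  pre-altPath plus zero = refl
  pre-altPath plus (suc j) = refl
  pre-altPath minus zero = refl
  pre-altPath minus (suc j) = refl

altF-prov : ∀ {A : Theory} s j {n} {Γ : List (Formula n)} → Der A Γ (altF s j)
altF-prov s zero = eq-refl 𝟎
altF-prov plus (suc j) = ∃I 𝟎 (cast (sym (altF-inst minus j)) (altF-prov minus j))
  where
  altF-sub : ∀ s j {n m} (σ : Subst n m) → sub σ (altF s j) ≡ altF s j
  altF-sub s zero σ = refl
  altF-sub plus (suc j) σ = cong ∃' (altF-sub minus j (lift σ))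
  altF-sub minus (suc j) σ = cong ∀' (altF-sub plus j (lift σ))
  altF-inst : ∀ s j {n} → altF s j [ 𝟎 {n} ] ≡ altF s j
  altF-inst s j = altF-sub s j _
altF-prov minus (suc j) = ∀I (altF-prov plus j)

pad-degree : ∀ s {n} j (φ : Formula n) → Degree≤ j φ → F j (φ ∧' altF s j)
pad-degree s {n} j φ h =
  ≤-antisym
    (Degree≤⇒F⁺ (φ ∧' altF s j)
      (Allₚ.++⁺ h (subst (All _) (sym (Alt-altF s {n} j)) (≤-reflexive (length-altPath s j) ∷ []))))
    (subst (_≤ deg (φ ∧' altF s j)) (length-altPath s j)
      (All.head (subst (All _) (Alt-altF s {n} j) (Allₚ.++⁻ʳ (Alt φ) (F⁺⇒Degree≤ (φ ∧' altF s j) ≤-refl)))))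

-- The only path of length `suc k` is the one of the padding, which starts with plus.
pad-E : ∀ {n} k (φ : Formula n) → Degree≤ k φ → E-suc k (φ ∧' altF plus (suc k))
pad-E {n} k φ h =
  pad-degree plus (suc k) φ (All.map (λ q → ≤-trans q (n≤1+n k)) h) ,
  Allₚ.++⁺ (All.map (λ q e → ⊥-elim (<⇒≢ (s≤s q) e)) h)
    (subst (All (λ s → length s ≡ suc k → head s ≡ just plus)) (sym (Alt-altF plus {n} (suc k))) ((λ _ → refl) ∷ []))

lem-degree : ∀ {n} k (φ : Formula n) → Sig k φ → Degree≤ k (φ ∨' ~ φ)
lem-degree k φ p = Allₚ.++⁺ (Sig-degree k p) (degree-~ φ (Sig-degree k p))

-- The equivalences

module Main (k : ℕ) (T : Formula 0 → Set) (sc : SemiClassical T)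
            (X : Formula 0 → Set) (X⊆Q : (ψ : Formula 0) → X ψ → Q⁺ k ψ) where

  A PA : Theory
  A = HA+ (T ∪ X)
  PA = PA+ X

  A-closed : SubClosed A
  A-closed = SentAx-closed (T ∪ X)

  open Logic A A-closed
  open Prenex A A-closed
  open Separation A A-closed
  open Translation A A-closed
  module C = Logic PA (PA-closed X)
  module CP = Prenex PA (PA-closed X)

  lem-PA : ∀ {m} → CP.LEM< m
  lem-PA _ φ _ = axm (inj₁ (φ , refl))

  -- Semi-classicality enters here: the premise of a rule, proved in T + X, becomes available to a
  -- classical argument before conservativity brings the conclusion back.
  A⊆PA : ∀ {n} {φ : Formula n} → A ⊢ φ → PA ⊢ φ
  A⊆PA = Der-map axiom (λ x → x)
    where
    axiom : ∀ {n} {Γ : List (Formula n)} {φ} → A φ → Der PA Γ φ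
    axiom (ψ , inj₁ t , refl) =
      Der-map (λ { (inj₁ l) → axm (inj₁ l) ; (inj₂ (_ , () , _)) }) (λ ()) (Der-sub (PA-closed ∅) (λ ()) (sc ψ t))
    axiom (ψ , inj₂ x , refl) = axm (inj₂ (ψ , x , refl))

  9⇒LEM< : Cond k T X 9 → LEM< (suc k)
  9⇒LEM< lem (s≤s i≤k) φ p = lem φ (Sig-mono i≤k p)

  9⇒1 : Cond k T X 9 → Cond k T X 1
  9⇒1 lem φ v d = conservative v d
    where
    open Decidable k (λ φ → degree-dec k (9⇒LEM< lem) φ)

    conservative : ∀ {n} {φ : Formula n} → V⁺ k φ → PA ⊢ φ → A ⊢ φ
    conservative (V-base {φ = φ} j) d =
      K-run (K-bind (sound X axiom d φ) (J-⟦⟧ j φ v0)) v0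
      where
      axiom : ∀ {n} ψ → X ψ → (C : Formula n) → A ⊢ K C (⟦ emb ψ ⟧ C)
      axiom ψ x C = Q-⟦⟧ (Q-sub _ (X⊆Q ψ x)) C (axm (ψ , inj₂ x , refl))
    conservative (V-∧ p q) d = ∧I (conservative p (∧E₁ d)) (conservative q (∧E₂ d))
    -- The outer ∀ is stripped on the classical side, leaving an open formula; the answer formula
    -- may contain free variables.
    conservative (V-∀ {a = a} p) d = ∀I (conservative p (C.∀E₀ a (C.⇑ d)))

  1⇒5 : Cond k T X 1 → Cond k T X 5
  1⇒5 cons φ ψ p q d =
    cons (dual φ ∨' dual ψ) (V-base (J-∨ (Sig⇒J⁺ k (Pi-dual (suc k) p)) (Sig⇒J⁺ k (Pi-dual (suc k) q))))
      (∨E (CP.Pi-∨-dual (suc k) lem-PA p)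
        (∨E (CP.Pi-∨-dual (suc k) lem-PA q)
          (⊥E (⇒E (C.closed (A⊆PA d)) (∧I C.v1 C.v0))) (∨I₂ C.v0))
        (∨I₁ C.v0))

  3⇒4 : Cond k T X 3 → Cond k T X 4
  3⇒4 cons φ p d =
    cons φ p (∨E (axm (inj₁ (φ , refl))) C.v0 (⊥E (⇒E (C.closed (A⊆PA d)) C.v0)))

  4⇒9 : Cond k T X 4 → Cond k T X 9
  4⇒9 dne = LEM-induction k step
    where
    step : ∀ j → suc j ≤ k → LEM< (suc j) → ProvesLEM (Sig (suc j)) A
    step j j<k L φ p
      with χ , q , f , g ← pull-∃ _∨'_ {P = Pi j} {Q = Pi (suc j)} {R = Pi (suc j)} (λ _ → ∃∨-pull) (Pi-sub (suc j) _)
             (λ p q → Eqv-ex (Eqv-⟺ ∨-swap (Pi-∨ (suc j) L q (Pi-suc j p) (Pi-dec j L p)))) p (Sig-dual (suc j) p)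
      -- Since j + 1 ≤ k, the prenex form χ of φ ∨ φ^⊥ is within reach of the rule. Its double
      -- negation holds because refuting χ refutes φ, and ¬φ already gives φ^⊥ with LEM(Σ_j).
      = ∨-dual⇒Dec (⇒E g (dne χ (Sig-mono (s≤s j<k) q)
          (⇒I (⇒E v0 (⇒E (closed f) (∨I₂ (⇒E (Sig-¬⇒dual j L p) (⇒I (⇒E v1 (⇒E (closed f) (∨I₁ v0)))))))))))

  mutual
    -- Dualizing twice restores the prefix and doubly negates the quantifier-free matrix, which is
    -- decidable.
    Sig-dual-dual : ∀ m {n} {φ : Formula n} {Γ} → Sig m φ → Der A Γ (dual (dual φ)) → Der A Γ φ
    Sig-dual-dual zero p d = QF-dual-dual p d
    Sig-dual-dual (suc m) (ex-base p) d = Pi-dual-dual m p d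
    Sig-dual-dual (suc m) (ex-step {φ = a} p) d = ∃E d (∃I₀ a (Sig-dual-dual (suc m) p v0))

    Pi-dual-dual : ∀ m {n} {φ : Formula n} {Γ} → Pi m φ → Der A Γ (dual (dual φ)) → Der A Γ φ
    Pi-dual-dual zero p d = QF-dual-dual p d
    Pi-dual-dual (suc m) (all-base p) d = Sig-dual-dual m p d
    Pi-dual-dual (suc m) (all-step {φ = a} p) d =
      cut d (∀I (Pi-dual-dual (suc m) p (∀E₀ (dual (dual a)) v0)))

    QF-dual-dual : ∀ {n} {φ : Formula n} {Γ} → QF φ → Der A Γ (dual (dual φ)) → Der A Γ φ
    QF-dual-dual p d =
      ∨E (QF-dec p) v0 (⊥E (⇒E (↑ (cast (cong dual (QF-dual p)) d)) v0))

  5⇒9 : Cond k T X 5 → Cond k T X 9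
  5⇒9 dmld φ p =
    -- φ and φ^⊥ are contradictory and both Π_{k+1}, the first with an empty ∀-block; the rule
    -- returns φ^⊥ or φ^⊥⊥.
    ∨E (dmld φ (dual φ) (all-base p) (Pi-suc k (Sig-dual k p)) (⇒I (⇒E (⇒E (dual⇒¬ φ) (∧E₂ v0)) (∧E₁ v0))))
      (∨I₂ (⇒E (dual⇒¬ φ) v0)) (∨I₁ (Sig-dual-dual k p v0))

  6⇒9 : Cond k T X 6 → Cond k T X 9
  6⇒9 cons φ p =
    ∧E₁ (cons ((φ ∨' ~ φ) ∧' altF plus (suc k)) (pad-E k (φ ∨' ~ φ) (lem-degree k φ p))
      (∧I (axm (inj₁ (φ , refl))) (altF-prov plus (suc k))))

  7⇒9 : Cond k T X 7 → Cond k T X 9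
  7⇒9 cons φ p =
    ∧E₁ (cons ((φ ∨' ~ φ) ∧' altF plus k) (pad-degree plus k (φ ∨' ~ φ) (lem-degree k φ p))
      (∧I (axm (inj₁ (φ , refl))) (altF-prov plus k)))

  8⇒9 : Cond k T X 8 → Cond k T X 9
  -- ¬φ is in general not prenex, so conservativity is applied to φ ∨ φ^⊥.
  8⇒9 cons φ p = ∨-dual⇒Dec (cons (φ ∨' dual φ) (sop p (Sig-dual k p)) (CP.Sig-∨-dual k lem-PA p))

  9⇒10 : Cond k T X 9 → Cond k T X 10
  9⇒10 lem φ ψ p q =
    ⇒I (∨E (closed (lem φ p)) (∨I₁ v0) (∨I₂ (∀I (∨E (∀E₀ (wk φ ∨' ψ) v1) (⊥E (⇒E v1 v0)) v0))))

  10⇒11 : Cond k T X 10 → Cond k T X 11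
  10⇒11 cd φ ψ p q d = ⇒E (cd φ ψ p q) d

  11⇒9 : Cond k T X 11 → Cond k T X 9
  11⇒9 cd = LEM-induction k step
    where
    step : ∀ j → suc j ≤ k → LEM< (suc j) → ProvesLEM (Sig (suc j)) A
    step j j<k L φ p with ψ , q , d , e ← separate j L φ p =
      ⇒E (∨-mono (⇒I v0) e) (cd φ ψ (Sig-mono j<k p) (Sig-mono j<k q) (∀I d))

  to-9 : ∀ i → 1 ≤ i × i ≤ 11 → Cond k T X i → Cond k T X 9
  to-9 0 (() , _)
  to-9 1 _ c = 4⇒9 (3⇒4 (λ φ p → c φ (V-base (Sig⇒J⁺ k p))))
  to-9 2 _ c = 4⇒9 (3⇒4 (λ φ p → c φ (all-base p)))
  to-9 3 _ c = 4⇒9 (3⇒4 c)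
  to-9 4 _ c = 4⇒9 c
  to-9 5 _ c = 5⇒9 c
  to-9 6 _ c = 6⇒9 c
  to-9 7 _ c = 7⇒9 c
  to-9 8 _ c = 8⇒9 c
  to-9 9 _ c = c
  to-9 10 _ c = 11⇒9 (10⇒11 c)
  to-9 11 _ c = 11⇒9 c
  to-9 (suc (suc (suc (suc (suc (suc (suc (suc (suc (suc (suc (suc _))))))))))))
    (_ , s≤s (s≤s (s≤s (s≤s (s≤s (s≤s (s≤s (s≤s (s≤s (s≤s (s≤s ())))))))))))

  from-1 : Cond k T X 9 → Cond k T X 1 → ∀ j → 1 ≤ j × j ≤ 11 → Cond k T X j
  from-1 lem c 0 (() , _)
  from-1 lem c 1 _ = c
  from-1 lem c 2 _ = λ φ p → c φ (Pi⇒V⁺ k p)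
  from-1 lem c 3 _ = λ φ p → c φ (V-base (Sig⇒J⁺ k p))
  from-1 lem c 4 _ = 3⇒4 (λ φ p → c φ (V-base (Sig⇒J⁺ k p)))
  from-1 lem c 5 _ = 1⇒5 c
  from-1 lem c 6 _ = λ φ p → c φ (V-base (Bounded⇒J⁺ k φ (E-suc⇒Bounded k φ p)))
  from-1 lem c 7 _ = λ φ p → c φ (V-base (J-base (≤-reflexive p)))
  from-1 lem c 8 _ = λ { φ (sop p q) → c φ (V-base (J-base (Degree≤⇒F⁺ φ (Allₚ.++⁺ (Sig-degree k p) (Pi-degree k q))))) }
  from-1 lem c 9 _ = lem
  from-1 lem c 10 _ = 9⇒10 lem
  from-1 lem c 11 _ = 10⇒11 (9⇒10 lem)
  from-1 lem c (suc (suc (suc (suc (suc (suc (suc (suc (suc (suc (suc (suc _))))))))))))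
    (_ , s≤s (s≤s (s≤s (s≤s (s≤s (s≤s (s≤s (s≤s (s≤s (s≤s (s≤s ())))))))))))

theorem5p9 : (k : ℕ) (T : Formula 0 → Set) → SemiClassical T →
    (X : Formula 0 → Set) → ((ψ : Formula 0) → X ψ → Q⁺ k ψ) →
    (i j : ℕ) → 1 ≤ i × i ≤ 11 → 1 ≤ j × j ≤ 11 →
    Cond k T X i → Cond k T X j
theorem5p9 k T sc X X⊆Q i j hi hj c = from-1 lem (9⇒1 lem) j hj
  where
  open Main k T sc X X⊆Q
  lem : Cond k T X 9
  lem = to-9 i hi c
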